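{- Let $\mathcal B$ be a Baer subplane of $\mathrm{PG}(2,q^2)$ tangent to $\ell_\infty$ at the point $\bar T=\mathcal B\cap\ell_\infty$, and let $\bar P\in\ell_\infty$, $\bar P\neq\bar T$. An $\ell_\infty$-Baer pencil with vertex $\bar P$ meets $\mathcal B$ either in a non-degenerate conic (of $\mathcal B$) through $\bar T$, or in two lines of $\mathcal B$, namely the unique line of $\mathcal B$ whose extension to $\mathrm{PG}(2,q^2)$ contains $\bar P$, and one line of $\mathcal B$ through $\bar T$. Of the $\ell_\infty$-Baer pencils with vertex $\bar P$, exactly $q^2-1$ are of the first type and exactly $q+1$ are of the second type (each containing one of the $q+1$ lines of $\mathcal B$ through $\bar T$).
   Context: $q$ is a prime power and $\ell_\infty$ is a fixed line of $\mathrm{PG}(2,q^2)$. A Baer pencil of $\mathrm{PG}(2,q^2)$ is the point set covered by the $q+1$ lines joining a vertex point $P$ to the points of a Baer subline $b$ (the base). An $\ell_\infty$-Baer pencil is a Baer pencil whose vertex lies on $\ell_\infty$ and whose base meets $\ell_\infty$ in a point. A Baer subplane is tangent to $\ell_\infty$ if it meets $\ell_\infty$ in exactly one point. A line of $\mathcal B$ means a Baer subline of $\mathcal B$ (i.e. a line of the subplane $\mathcal B\cong\mathrm{PG}(2,q)$); its extension is the line of $\mathrm{PG}(2,q^2)$ containing it. -}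

module Defs where

open import Level using (Level; _⊔_)
open import Data.Nat as ℕ using (ℕ; zero; suc)
open import Data.Nat.Primality using (Prime)
open import Data.Fin as Fin using (Fin)
open import Data.Product using (Σ; ∃; ∃₂; _×_; _,_)
open import Data.Sum using (_⊎_)
open import Data.List using (List; length)
open import Data.List.Relation.Unary.All using (All)
open import Data.List.Relation.Unary.Any using (Any)
open import Data.List.Relation.Unary.AllPairs using (AllPairs)
open import Relation.Nullary using (¬_)
open import Relation.Binary.PropositionalEquality using (_≡_)
open import Algebra.Bundles using (CommutativeRing)

PrimePower : ℕ → Set
PrimePower q = ∃₂ λ p k → Prime p × q ≡ p ℕ.^ suc k

record Field (c ℓ : Level) : Set (Level.suc (c ⊔ ℓ)) where
  field
    commutativeRing : CommutativeRing c ℓ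
  open CommutativeRing commutativeRing public
  field
    0≉1 : ¬ (0# ≈ 1#)
    inverse : ∀ x → ¬ (x ≈ 0#) → ∃ λ y → x * y ≈ 1#

HasSize : ∀ {c ℓ} → Field c ℓ → ℕ → Set (c ⊔ ℓ)
HasSize F n = ∃ λ (xs : List Carrier) →
    length xs ≡ n × (∀ x → Any (x ≈_) xs) × AllPairs (λ a b → ¬ (a ≈ b)) xs
  where open Field F

-- Projective plane PG(2,F) in homogeneous coordinates; q is used to define
-- the subfield GF(q) = { x | x^q = x } of F = GF(q^2).
module PG {c ℓ} (F : Field c ℓ) (q : ℕ) where
  open Field F using (Carrier; _≈_; _+_; _*_; _-_; 0#; 1#)

  L : Level
  L = c ⊔ ℓ

  pow : Carrier → ℕ → Carrier
  pow x ℕ.zero = 1#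
  pow x (ℕ.suc n) = x * pow x n

  InK : Carrier → Set ℓ
  InK x = pow x q ≈ x

  V : Set c
  V = Fin 3 → Carrier

  v₀ v₁ v₂ : V → Carrier
  v₀ v = v Fin.zero
  v₁ v = v (Fin.suc Fin.zero)
  v₂ v = v (Fin.suc (Fin.suc Fin.zero))

  InK³ : V → Set ℓ
  InK³ v = ∀ i → InK (v i)

  NonZero : V → Set ℓ
  NonZero v = ¬ (∀ i → v i ≈ 0#)

  _∼_ : V → V → Set L
  u ∼ v = ∃ λ k → ¬ (k ≈ 0#) × (∀ i → u i ≈ k * v i)

  dot : V → V → Carrier
  dot a v = v₀ a * v₀ v + v₁ a * v₁ v + v₂ a * v₂ v

  OnLine : V → V → Set ℓ
  OnLine a v = dot a v ≈ 0#

  lin : Carrier → V → Carrier → V → V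
  lin s x t y i = s * x i + t * y i

  det3 : V → V → V → Carrier
  det3 a b d = v₀ a * (v₁ b * v₂ d - v₂ b * v₁ d)
             - v₁ a * (v₀ b * v₂ d - v₂ b * v₀ d)
             + v₂ a * (v₀ b * v₁ d - v₁ b * v₀ d)

  Matrix : Set c
  Matrix = Fin 3 → V   -- rows

  apply : Matrix → V → V
  apply M w i = dot (M i) w

  det : Matrix → Carrier
  det M = det3 (M Fin.zero) (M (Fin.suc Fin.zero)) (M (Fin.suc (Fin.suc Fin.zero)))

  Nonsingular : Matrix → Set ℓ
  Nonsingular M = ¬ (det M ≈ 0#)

  PointSet : Set (Level.suc L)
  PointSet = V → Set L

  _≐_ : PointSet → PointSet → Set L
  S ≐ T = ∀ v → NonZero v → (S v → T v) × (T v → S v)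

  _∩_ : PointSet → PointSet → PointSet
  (S ∩ T) v = S v × T v

  _∪_ : PointSet → PointSet → PointSet
  (S ∪ T) v = S v ⊎ T v

  -- The Baer subplane B_M = M(PG(2,q)), image of the canonical subplane under
  -- the nonsingular matrix M.
  Baer : Matrix → PointSet
  Baer M v = ∃ λ w → InK³ w × NonZero w × v ∼ apply M w

  KLine : V → Set ℓ
  KLine c' = InK³ c' × NonZero c'

  BLine : Matrix → V → PointSet
  BLine M c' v = ∃ λ w → InK³ w × NonZero w × OnLine c' w × v ∼ apply M w

  BLineExt : Matrix → V → PointSet
  BLineExt M c' v = ∃ λ w → NonZero w × OnLine c' w × v ∼ apply M w

  record QForm : Set c where
    constructor qform
    field a b cc f g h : Carrier

  evalQ : QForm → V → Carrier
  evalQ Q w = a * (x * x) + b * (y * y) + cc * (z * z) + f * (y * z) + g * (x * z) + h * (x * y)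
    where
      open QForm Q
      x = v₀ w
      y = v₁ w
      z = v₂ w

  NondegKConic : QForm → Set ℓ
  NondegKConic Q = (InK a × InK b × InK cc × InK f × InK g × InK h)
      × ¬ ((1# + 1# + 1# + 1#) * a * b * cc + f * g * h - a * (f * f) - b * (g * g) - cc * (h * h) ≈ 0#)
    where open QForm Q

  BConic : Matrix → QForm → PointSet
  BConic M Q v = ∃ λ w → InK³ w × NonZero w × evalQ Q w ≈ 0# × v ∼ apply M w

  Subline : V → V → PointSet
  Subline x y v = ∃₂ λ s t → InK s × InK t × ¬ (s ≈ 0# × t ≈ 0#) × v ∼ lin s x t y

  -- Baer pencil with vertex P and base the Baer subline generated by x, y,
  -- where P is not on the line spanned by x and y (P, x, y independent)
  Pencil : V → V → V → PointSet
  Pencil P x y v = ∃ λ X → Subline x y X × ∃₂ λ s t → ¬ (s ≈ 0# × t ≈ 0#) × v ∼ lin s P t X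

  LinfPencil : V → V → V → V → Set L
  LinfPencil l P x y = ¬ (det3 P x y ≈ 0#) × NonZero P × OnLine l P
                      × ∃ λ X → Subline x y X × OnLine l X

  TangentAt : V → Matrix → V → Set L
  TangentAt l M T = NonZero T × Baer M T × OnLine l T
                    × (∀ v → NonZero v → Baer M v → OnLine l v → v ∼ T)

  Type1 : Matrix → V → PointSet → Set L
  Type1 M T S = ∃ λ Q → NondegKConic Q × BConic M Q T × (S ∩ Baer M) ≐ BConic M Q

  Type2With : Matrix → V → V → V → PointSet → Set L
  Type2With M T P c₂ S = KLine c₂ × BLine M c₂ T
      × ∃ λ c₁ → KLine c₁ × BLineExt M c₁ P × (S ∩ Baer M) ≐ (BLine M c₁ ∪ BLine M c₂)

  Type2 : Matrix → V → V → PointSet → Set L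
  Type2 M T P S = ∃ λ c₂ → Type2With M T P c₂ S

  ExactlyPencils : ℕ → V → V → (PointSet → Set L) → Set L
  ExactlyPencils n l P Good = ∃ λ (bs : List (V × V)) →
      length bs ≡ n
    × All (λ { (x , y) → LinfPencil l P x y × Good (Pencil P x y) }) bs
    × AllPairs (λ { (x , y) (x' , y') → ¬ (Pencil P x y ≐ Pencil P x' y') }) bs
    × (∀ x y → LinfPencil l P x y → Good (Pencil P x y)
         → Any (λ { (x' , y') → Pencil P x y ≐ Pencil P x' y' }) bs)

{-# OPTIONS --safe #-}
module Submission where

-- Pull everything back along M, so that the subplane consists of the vectors
-- over K = { x | x^q = x } and bar x = x^q is the conjugation of F over K. Let p
-- be the vertex and t the tangent point. Tangency makes p, bar p and t
-- independent, and every vector over K has the form u p + ū (bar p) + r t with r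
-- in K. The lines through p other than l form an affine line over F with
-- coordinate z = r/ū, and the pencils in question are its affine K-lines
-- { a + k b | k ∈ K }. In the subplane such a pencil has the equation
-- r (b̄ u - b ū) = δ u ū, where δ = a b̄ - ā b. If δ = 0, that is if the affine
-- K-line passes through 0, this is the pair of lines r = 0 and b̄ u = b ū; there
-- are q + 1 such K-lines. If δ ≠ 0 it is a conic with discriminant a nonzero
-- multiple of b b̄ δ, and the K-line is determined by b/δ, an arbitrary nonzero
-- element of F; this gives q² - 1 pencils.

-- The device that keeps the argument polynomial: for nonzero `y`, the quotient `x / y` lies in K
-- exactly when `x * bar y` does, since the two differ by the norm `y * bar y`, a nonzero element of
-- K. Stated this way, membership in a K-line still makes sense when a denominator vanishes, so the
-- vertex and the line l need no treatment of their own. The determinants that arise are skew, that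
-- is, negated by conjugation. The factor `Δ`, itself skew, makes them real, and for this reason the
-- coordinate used below is `Δ` times the z of the overview. Nothing is halved, because q may be
-- even. The exact counts need more than the two lists: no pencil may be of both types. This rests
-- on a nondegenerate conic containing no line of the subplane, which has to be shown with three
-- points of the line, as q may be 2. That K has q elements follows from F = K + ωK, where ω outside
-- K is extracted from the vertex.

open import Defs
open import Level using (Level; _⊔_)
open import Algebra.Bundles using (CommutativeRing; CommutativeMonoid)
import Algebra.Properties.CommutativeSemigroup
import Algebra.Properties.Ring
open import Data.Bool using (Bool; true; false; not; _xor_; if_then_else_)
open import Data.Empty using (⊥-elim)
open import Data.Fin using (Fin; zero; suc; toℕ; fromℕ; inject₁)
open import Data.Fin.Patterns using (0F; 1F; 2F)
open import Data.Fin.Permutation using (permutation)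
open import Data.Fin.Properties using (injective⇒≤; toℕ-fromℕ; toℕ-inject₁; toℕ<n)
open import Data.List using (List; []; _∷_; map; foldr; length; lookup; filter; cartesianProduct)
open import Data.List.Membership.Setoid.Properties
  using (∈-lookup; ∈-filter⁺; ∈-filter⁻; ∈-cartesianProduct⁺; ∈-cartesianProduct⁻; ∈-map⁻)
open import Data.List.Properties using (length-++; length-map)
open import Data.List.Relation.Unary.All as All using (All; []; _∷_)
import Data.List.Relation.Unary.All.Properties as All
open import Data.List.Relation.Unary.AllPairs as AllPairs using (AllPairs; []; _∷_)
import Data.List.Relation.Unary.AllPairs.Properties as AllPairs
open import Data.List.Relation.Unary.Any as Any using (Any; here; there)
import Data.List.Relation.Unary.Any.Properties as Any
open import Data.List.Relation.Unary.Unique.Setoid.Properties using (filter⁺; cartesianProduct⁺; map⁺)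
open import Data.Nat as ℕ using (ℕ; zero; suc; _∸_; _≤_; _<_; _<ᵇ_; _!; z≤n; s≤s)
open import Data.Nat.Combinatorics using (_C_; nCn≡1; nCk≡n!/k![n-k]!; k![n∸k]!∣n!)
open import Data.Nat.DivMod using (m/n*n≡m)
open import Data.Nat.Divisibility using (_∣_; divides; ∣⇒≤; ∣m⇒∣m*n; ∣-refl; ∣1⇒≡1)
open import Data.Nat.Primality using (Prime; euclidsLemma; prime⇒nonZero; prime⇒nonTrivial)
import Data.Nat.Properties as ℕₚ
open import Data.Product using (_×_; _,_; proj₁; proj₂; ∃; ∃₂)
open import Data.Product.Relation.Binary.Pointwise.NonDependent using (_×ₛ_)
open import Data.Sum using (_⊎_; inj₁; inj₂; [_,_]′)
open import Function using (_∘_)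
open import Relation.Binary.Bundles using (Setoid)
open import Relation.Binary.Definitions using (Decidable; tri<; tri≈; tri>)
open import Relation.Binary.PropositionalEquality as ≡ using (_≡_)
open import Relation.Nullary using (Dec; yes; no; ¬_; ¬?)

-- Binomial coefficients modulo a prime

prime∣!⇒≤ : ∀ {p} → Prime p → ∀ n → p ∣ n ! → p ≤ n
prime∣!⇒≤ pr zero p∣1 = ⊥-elim (ℕₚ.<-irrefl (≡.sym (∣1⇒≡1 p∣1)) (ℕ.nonTrivial⇒n>1 _ {{prime⇒nonTrivial pr}}))
prime∣!⇒≤ pr (suc n) p∣ = [ ∣⇒≤ , ℕₚ.m≤n⇒m≤1+n ∘ prime∣!⇒≤ pr n ]′ (euclidsLemma (suc n) (n !) pr p∣)

-- `p` divides `p !`, the product of the binomial coefficient with `k !` and `(p ∸ k) !`, and it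
-- divides neither of these factorials because `k` and `p ∸ k` are smaller than `p`.
prime∣binomial : ∀ {p k} → Prime p → 0 < k → k < p → p ∣ (p C k)
prime∣binomial {p} {k} pr 0<k k<p =
  [ (λ h → h) , ⊥-elim ∘ [ too-small k<p , too-small p∸k<p ]′ ∘ euclidsLemma (k !) ((p ∸ k) !) pr ]′
    (euclidsLemma (p C k) (k ! ℕ.* (p ∸ k) !) pr (≡.subst (p ∣_) (≡.sym factorials) p∣p!))
  where
  p∸k<p : p ∸ k < p
  p∸k<p = ℕₚ.∸-monoʳ-< 0<k (ℕₚ.<⇒≤ k<p)
  too-small : ∀ {n} → n < p → ¬ (p ∣ n !)
  too-small n<p p∣n! = ℕₚ.<⇒≱ n<p (prime∣!⇒≤ pr _ p∣n!)
  p∣p! : p ∣ p !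
  p∣p! = divides-factorial p (ℕₚ.<-trans 0<k k<p)
    where
    divides-factorial : ∀ n → 0 < n → n ∣ n !
    divides-factorial (suc n) _ = ∣m⇒∣m*n (n !) ∣-refl
  factorials : (p C k) ℕ.* (k ! ℕ.* (p ∸ k) !) ≡ p !
  factorials = ≡.trans (≡.cong (ℕ._* (k ! ℕ.* (p ∸ k) !)) (nCk≡n!/k![n-k]! (ℕₚ.<⇒≤ k<p)))
    (m/n*n≡m {{ k ℕₚ.!* (p ∸ k) !≢0 }} (k![n∸k]!∣n! (ℕₚ.<⇒≤ k<p)))

length-cartesianProduct : ∀ {a b} {A : Set a} {B : Set b} (xs : List A) (ys : List B) →
  length (cartesianProduct xs ys) ≡ length xs ℕ.* length ys
length-cartesianProduct [] ys = ≡.refl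
length-cartesianProduct (x ∷ xs) ys = ≡.trans (length-++ (map (x ,_) ys))
  (≡.cong₂ ℕ._+_ (length-map (x ,_) ys) (length-cartesianProduct xs ys))

-- Lists without repetition and reindexed sums

module UniqueLists {c ℓ} (S : Setoid c ℓ) where
  open Setoid S
  open import Data.List.Membership.Setoid S using (_∈_)
  open import Data.List.Relation.Unary.Unique.Setoid S using (Unique)

  ∉-lookup : ∀ {x xs} → All (λ y → ¬ (x ≈ y)) xs → ∀ i → ¬ (x ≈ lookup xs i)
  ∉-lookup (h ∷ _) zero = h
  ∉-lookup (_ ∷ hs) (suc i) = ∉-lookup hs i

  lookup-injective : ∀ {xs} → Unique xs → ∀ i j → lookup xs i ≈ lookup xs j → i ≡ j
  lookup-injective (_ ∷ _) zero zero _ = ≡.refl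
  lookup-injective (x∉ ∷ _) zero (suc j) e = ⊥-elim (∉-lookup x∉ j e)
  lookup-injective (x∉ ∷ _) (suc i) zero e = ⊥-elim (∉-lookup x∉ i (sym e))
  lookup-injective (_ ∷ u) (suc i) (suc j) e = ≡.cong suc (lookup-injective u i j e)

  module _ {xs ys} (xs! : Unique xs) (xs⊆ys : ∀ {x} → x ∈ xs → x ∈ ys) where

    private
      position : Fin (length xs) → Fin (length ys)
      position i = Any.index (xs⊆ys (∈-lookup S xs i))

      position-injective : ∀ {i j} → position i ≡ position j → i ≡ j
      position-injective {i} {j} e = lookup-injective xs! i j
        (trans (Any.lookup-index (xs⊆ys (∈-lookup S xs i)))
          (trans (reflexive (≡.cong (lookup ys) e)) (sym (Any.lookup-index (xs⊆ys (∈-lookup S xs j))))))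

    length-⊆ : length xs ≤ length ys
    length-⊆ = injective⇒≤ position-injective

  length-unique : ∀ {xs ys} → Unique xs → Unique ys → (∀ {x} → x ∈ xs → x ∈ ys) → (∀ {x} → x ∈ ys → x ∈ xs) →
    length xs ≡ length ys
  length-unique xs! ys! xs⊆ys ys⊆xs = ℕₚ.≤-antisym (length-⊆ xs! xs⊆ys) (length-⊆ ys! ys⊆xs)

module ReindexedSums {c ℓ} (M : CommutativeMonoid c ℓ) where
  open CommutativeMonoid M
  open UniqueLists setoid
  open import Data.List.Membership.Setoid setoid using (_∈_)
  open import Data.List.Relation.Unary.Unique.Setoid setoid using (Unique)
  open import Algebra.Properties.CommutativeMonoid.Sum M using (sum; sum-permute; sum-cong-≋)

  -- A bijection of the entries induces a permutation of the positions. It is applied to translation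
  -- by `1#` for the characteristic and, multiplicatively, to multiplication by a nonzero element
  -- for Fermat's theorem.
  sum-reindex : ∀ {xs} (φ ψ : Carrier → Carrier) → Unique xs →
    (∀ {x y} → x ≈ y → φ x ≈ φ y) → (∀ {x y} → x ≈ y → ψ x ≈ ψ y) →
    (∀ {x} → x ∈ xs → φ x ∈ xs) → (∀ {x} → x ∈ xs → ψ x ∈ xs) →
    (∀ x → φ (ψ x) ≈ x) → (∀ x → ψ (φ x) ≈ x) → sum (lookup xs) ≈ sum (φ ∘ lookup xs)
  sum-reindex {xs} φ ψ xs! φ-cong ψ-cong φ-in ψ-in φψ ψφ =
    trans (sum-permute (lookup xs) (permutation (at φ-in) (at ψ-in)
        (inverse φ-cong φψ φ-in ψ-in) (inverse ψ-cong ψφ ψ-in φ-in)))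
      (sum-cong-≋ (λ i → sym (at-correct φ-in i)))
    where
    at : ∀ {f : Carrier → Carrier} → (∀ {x} → x ∈ xs → f x ∈ xs) → Fin (length xs) → Fin (length xs)
    at f-in i = Any.index (f-in (∈-lookup setoid xs i))
    at-correct : ∀ {f : Carrier → Carrier} (f-in : ∀ {x} → x ∈ xs → f x ∈ xs) i →
      f (lookup xs i) ≈ lookup xs (at f-in i)
    at-correct f-in i = Any.lookup-index (f-in (∈-lookup setoid xs i))
    inverse : ∀ {f g : Carrier → Carrier} → (∀ {x y} → x ≈ y → f x ≈ f y) → (∀ x → f (g x) ≈ x) →
      (f-in : ∀ {x} → x ∈ xs → f x ∈ xs) (g-in : ∀ {x} → x ∈ xs → g x ∈ xs) → ∀ i → at f-in (at g-in i) ≡ i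
    inverse f-cong fg f-in g-in i = lookup-injective xs! _ _ (trans (sym (at-correct f-in (at g-in i)))
      (trans (f-cong (sym (at-correct g-in i))) (fg _)))

-- A solver for commutative rings with involution

record Involution {c ℓ} (R : CommutativeRing c ℓ) : Set (c ⊔ ℓ) where
  open CommutativeRing R
  open Algebra.Properties.Ring ring
  field
    bar : Carrier → Carrier
    bar-cong : ∀ {x y} → x ≈ y → bar x ≈ bar y
    bar-+ : ∀ x y → bar (x + y) ≈ bar x + bar y
    bar-* : ∀ x y → bar (x * y) ≈ bar x * bar y
    bar-involutive : ∀ x → bar (bar x) ≈ x

  bar-0# : bar 0# ≈ 0#
  bar-0# = x≈x+x⇒x≈0 (trans (bar-cong (sym (+-identityʳ 0#))) (bar-+ 0# 0#))
    where
    x≈x+x⇒x≈0 : ∀ {x} → x ≈ x + x → x ≈ 0#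
    x≈x+x⇒x≈0 {x} e = sym (+-cancelˡ x 0# x (trans (+-identityʳ x) e))

  -- Additivity and multiplicativity alone would allow `bar 1#` to be `0#`. Involutivity excludes
  -- this: `bar 1# = bar 1# * bar (bar 1#) = bar (1# * bar 1#) = 1#`.
  bar-1# : bar 1# ≈ 1#
  bar-1# = trans (sym (*-identityʳ _)) (trans (*-congˡ (sym (bar-involutive 1#)))
    (trans (sym (bar-* 1# (bar 1#))) (trans (bar-cong (*-identityˡ _)) (bar-involutive 1#))))

  bar-neg : ∀ x → bar (- x) ≈ - bar x
  bar-neg x = +-inverseˡ-unique _ _
    (trans (sym (bar-+ (- x) x)) (trans (bar-cong (-‿inverseˡ x)) bar-0#))

module InvolutionSolver {c ℓ} (R : CommutativeRing c ℓ) (ι : Involution R) where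
  open CommutativeRing R hiding (zero)
  open Involution ι
  open Algebra.Properties.Ring ring
  private
    module *P = Algebra.Properties.CommutativeSemigroup *-commutativeSemigroup
    module +P = Algebra.Properties.CommutativeSemigroup
      (CommutativeMonoid.commutativeSemigroup +-commutativeMonoid)

  infixl 6 _:+_ _:-_
  infixl 7 _:*_
  infix 8 :-_
  infix 5 _:=_

  data Expr : Set where
    var : ℕ → Expr
    :0 :1 : Expr
    _:+_ _:*_ : Expr → Expr → Expr
    :-_ conj : Expr → Expr

  _:-_ : Expr → Expr → Expr
  x :- y = x :+ (:- y)

  Env : Set c
  Env = ℕ → Carrier

  ⟦_⟧ : Expr → Env → Carrier
  ⟦ var i ⟧ ρ = ρ i
  ⟦ :0 ⟧ ρ = 0#
  ⟦ :1 ⟧ ρ = 1#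
  ⟦ x :+ y ⟧ ρ = ⟦ x ⟧ ρ + ⟦ y ⟧ ρ
  ⟦ x :* y ⟧ ρ = ⟦ x ⟧ ρ * ⟦ y ⟧ ρ
  ⟦ :- x ⟧ ρ = - ⟦ x ⟧ ρ
  ⟦ conj x ⟧ ρ = bar (⟦ x ⟧ ρ)

  -- The letters 2i and 2i+1 stand for the i-th variable and its conjugate, a
  -- monomial is a sorted word, and a multiple of a monomial is a repeated term.
  Word Poly : Set
  Term : Set
  Word = List ℕ
  Term = Bool × Word
  Poly = List Term

  -- Only equality carries evidence. A wrong `lt` or `gt` could leave like terms uncollected but
  -- could not make a normal form unsound.
  data Order {A : Set} (x y : A) : Set where
    lt gt : Order x y
    eq : x ≡ y → Order x y

  compareℕ : ∀ m n → Order m n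
  compareℕ m n with m ℕ.≟ n
  ... | yes e = eq e
  ... | no _ = if m <ᵇ n then lt else gt

  compareLex : ∀ u v → Order {Word} u v
  compareLex [] [] = eq ≡.refl
  compareLex [] (_ ∷ _) = lt
  compareLex (_ ∷ _) [] = gt
  compareLex (m ∷ u) (n ∷ v) with compareℕ m n
  ... | lt = lt
  ... | gt = gt
  ... | eq ≡.refl with compareLex u v
  ... | lt = lt
  ... | gt = gt
  ... | eq ≡.refl = eq ≡.refl

  -- Comparing lengths first makes the order compatible with multiplication.
  compareWord : ∀ u v → Order {Word} u v
  compareWord u v with compareℕ (length u) (length v)
  ... | lt = lt
  ... | gt = gt
  ... | eq _ = compareLex u v

  insert : ℕ → Word → Word
  insert x [] = x ∷ []
  insert x (y ∷ w) = if y <ᵇ x then y ∷ insert x w else x ∷ y ∷ w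

  _·_ : Word → Word → Word
  u · v = foldr insert v u

  -- The three polynomials are the merges that remain after removing the left head, the right head,
  -- or both. As they are arguments, `pick-correct` can split on the comparison outside the
  -- recursion of `add`.
  pick : ∀ {t u : Term} → Order (proj₂ t) (proj₂ u) → Poly → Poly → Poly → Poly
  pick {t} lt p _ _ = t ∷ p
  pick {_} {u} gt _ q _ = u ∷ q
  pick {t} {u} (eq _) p _ r = if proj₁ t xor proj₁ u then r else t ∷ p

  add : Poly → Poly → Poly
  add [] q = q
  add (t ∷ p) [] = t ∷ p
  add (t ∷ p) (u ∷ q) =
    pick {t} {u} (compareWord (proj₂ t) (proj₂ u)) (add p (u ∷ q)) (add (t ∷ p) q) (add p q)

  mulTerm : Term → Poly → Poly
  mulTerm (b , u) = map (λ { (b' , v) → b xor b' , u · v })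

  mul : Poly → Poly → Poly
  mul p q = foldr (λ t → add (mulTerm t q)) [] p

  neg : Poly → Poly
  neg = map (λ { (b , u) → not b , u })

  double : ℕ → ℕ
  double zero = zero
  double (suc n) = suc (suc (double n))

  -- The flag tells whether the expression stands under an odd number of `conj`. Conjugation is
  -- thereby pushed down to the variables, and polynomials never have to be conjugated.
  normalise : Bool → Expr → Poly
  normalise b (var i) = (false , (if b then suc (double i) else double i) ∷ []) ∷ []
  normalise b :0 = []
  normalise b :1 = (false , []) ∷ []
  normalise b (x :+ y) = add (normalise b x) (normalise b y)
  normalise b (x :* y) = mul (normalise b x) (normalise b y)
  normalise b (:- x) = neg (normalise b x)
  normalise b (conj x) = normalise (not b) x

  letter : Env → ℕ → Carrier
  letter ρ zero = ρ zero
  letter ρ (suc zero) = bar (ρ zero)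
  letter ρ (suc (suc n)) = letter (λ i → ρ (suc i)) n

  word : Env → Word → Carrier
  word ρ [] = 1#
  word ρ (x ∷ w) = letter ρ x * word ρ w

  sign : Bool → Carrier → Carrier
  sign false x = x
  sign true x = - x

  term : Env → Term → Carrier
  term ρ (b , w) = sign b (word ρ w)

  poly : Env → Poly → Carrier
  poly ρ [] = 0#
  poly ρ (t ∷ p) = term ρ t + poly ρ p

  conjIf : Bool → Carrier → Carrier
  conjIf false x = x
  conjIf true x = bar x

  module _ (ρ : Env) where

    insert-correct : ∀ x w → word ρ (insert x w) ≈ letter ρ x * word ρ w
    insert-correct x [] = refl
    insert-correct x (y ∷ w) with y <ᵇ x
    ... | true = trans (*-congˡ (insert-correct x w)) (*P.x∙yz≈y∙xz _ _ _)
    ... | false = refl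

    ·-correct : ∀ u v → word ρ (u · v) ≈ word ρ u * word ρ v
    ·-correct [] v = sym (*-identityˡ _)
    ·-correct (x ∷ u) v =
      trans (insert-correct x (u · v)) (trans (*-congˡ (·-correct u v)) (sym (*-assoc _ _ _)))

    opposite-terms : ∀ b b' w → b xor b' ≡ true → term ρ (b , w) + term ρ (b' , w) ≈ 0#
    opposite-terms true false w _ = -‿inverseˡ _
    opposite-terms false true w _ = -‿inverseʳ _

    pick-correct : ∀ {t u} o {p q x y z} →
      poly ρ x ≈ poly ρ p + poly ρ (u ∷ q) → poly ρ y ≈ poly ρ (t ∷ p) + poly ρ q →
      poly ρ z ≈ poly ρ p + poly ρ q →
      poly ρ (pick {t} {u} o x y z) ≈ poly ρ (t ∷ p) + poly ρ (u ∷ q)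
    pick-correct lt hx _ _ = trans (+-congˡ hx) (sym (+-assoc _ _ _))
    pick-correct gt _ hy _ = trans (+-congˡ hy) (+P.x∙yz≈y∙xz _ _ _)
    pick-correct {b , w} {b' , _} (eq ≡.refl) hx _ hz with b xor b' in e
    ... | false = trans (+-congˡ hx) (sym (+-assoc _ _ _))
    ... | true = trans hz (trans (sym (+-identityˡ _))
                   (trans (+-congʳ (sym (opposite-terms b b' w e))) (+P.interchange _ _ _ _)))

    add-correct : ∀ p q → poly ρ (add p q) ≈ poly ρ p + poly ρ q
    add-correct [] q = sym (+-identityˡ _)
    add-correct (t ∷ p) [] = sym (+-identityʳ _)
    add-correct (t ∷ p) (u ∷ q) = pick-correct (compareWord (proj₂ t) (proj₂ u)) {p} {q}
      (add-correct p (u ∷ q)) (add-correct (t ∷ p) q) (add-correct p q)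

    sign-* : ∀ b b' x y → sign (b xor b') (x * y) ≈ sign b x * sign b' y
    sign-* false false x y = refl
    sign-* false true x y = -‿distribʳ-* x y
    sign-* true false x y = -‿distribˡ-* x y
    sign-* true true x y = sym (trans (sym (-‿distribˡ-* x (- y)))
      (trans (-‿cong (sym (-‿distribʳ-* x y))) (-‿involutive _)))

    sign-cong : ∀ b {x y} → x ≈ y → sign b x ≈ sign b y
    sign-cong false e = e
    sign-cong true e = -‿cong e

    mulTerm-correct : ∀ t p → poly ρ (mulTerm t p) ≈ term ρ t * poly ρ p
    mulTerm-correct t [] = sym (zeroʳ _)
    mulTerm-correct t@(b , u) ((b' , v) ∷ p) = trans
      (+-cong (trans (sign-cong (b xor b') (·-correct u v)) (sign-* b b' _ _)) (mulTerm-correct t p))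
      (sym (distribˡ _ _ _))

    mul-correct : ∀ p q → poly ρ (mul p q) ≈ poly ρ p * poly ρ q
    mul-correct [] q = sym (zeroˡ _)
    mul-correct (t ∷ p) q = trans (add-correct (mulTerm t q) (mul p q))
      (trans (+-cong (mulTerm-correct t q) (mul-correct p q)) (sym (distribʳ _ _ _)))

    neg-correct : ∀ p → poly ρ (neg p) ≈ - poly ρ p
    neg-correct [] = sym -0#≈0#
    neg-correct ((b , w) ∷ p) =
      trans (+-cong (sign-not b (word ρ w)) (neg-correct p)) (-‿+-comm _ _)
      where
      sign-not : ∀ b x → sign (not b) x ≈ - sign b x
      sign-not false x = refl
      sign-not true x = sym (-‿involutive x)

  letter-double : ∀ ρ i → letter ρ (double i) ≈ ρ i
  letter-double ρ zero = refl
  letter-double ρ (suc i) = letter-double (λ j → ρ (suc j)) i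

  letter-suc-double : ∀ ρ i → letter ρ (suc (double i)) ≈ bar (ρ i)
  letter-suc-double ρ zero = refl
  letter-suc-double ρ (suc i) = letter-suc-double (λ j → ρ (suc j)) i

  normalise-correct : ∀ ρ b x → poly ρ (normalise b x) ≈ conjIf b (⟦ x ⟧ ρ)
  normalise-correct ρ false (var i) =
    trans (+-identityʳ _) (trans (*-identityʳ _) (letter-double ρ i))
  normalise-correct ρ true (var i) =
    trans (+-identityʳ _) (trans (*-identityʳ _) (letter-suc-double ρ i))
  normalise-correct ρ false :0 = refl
  normalise-correct ρ true :0 = sym bar-0#
  normalise-correct ρ false :1 = +-identityʳ _
  normalise-correct ρ true :1 = trans (+-identityʳ _) (sym bar-1#)
  normalise-correct ρ b (x :+ y) = trans (add-correct ρ (normalise b x) (normalise b y))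
    (trans (+-cong (normalise-correct ρ b x) (normalise-correct ρ b y)) (lemma b))
    where
    lemma : ∀ b → conjIf b (⟦ x ⟧ ρ) + conjIf b (⟦ y ⟧ ρ) ≈ conjIf b (⟦ x ⟧ ρ + ⟦ y ⟧ ρ)
    lemma false = refl
    lemma true = sym (bar-+ _ _)
  normalise-correct ρ b (x :* y) = trans (mul-correct ρ (normalise b x) (normalise b y))
    (trans (*-cong (normalise-correct ρ b x) (normalise-correct ρ b y)) (lemma b))
    where
    lemma : ∀ b → conjIf b (⟦ x ⟧ ρ) * conjIf b (⟦ y ⟧ ρ) ≈ conjIf b (⟦ x ⟧ ρ * ⟦ y ⟧ ρ)
    lemma false = refl
    lemma true = sym (bar-* _ _)
  normalise-correct ρ b (:- x) =
    trans (neg-correct ρ (normalise b x)) (trans (-‿cong (normalise-correct ρ b x)) (lemma b))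
    where
    lemma : ∀ b → - conjIf b (⟦ x ⟧ ρ) ≈ conjIf b (- ⟦ x ⟧ ρ)
    lemma false = refl
    lemma true = sym (bar-neg _)
  normalise-correct ρ false (conj x) = normalise-correct ρ true x
  normalise-correct ρ true (conj x) =
    trans (normalise-correct ρ false x) (sym (bar-involutive _))

  data Equation : Set where
    _:=_ : Expr → Expr → Equation

  Holds : Equation → Env → Set ℓ
  Holds (x := y) ρ = ⟦ x ⟧ ρ ≈ ⟦ y ⟧ ρ

  difference : Equation → Expr
  difference (x := y) = x :- y

  difference-zero : ∀ e ρ → Holds e ρ → ⟦ difference e ⟧ ρ ≈ 0#
  difference-zero (x := y) ρ h = trans (+-congʳ h) (-‿inverseʳ _)

  zero-difference : ∀ e ρ → ⟦ difference e ⟧ ρ ≈ 0# → Holds e ρ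
  zero-difference (x := y) ρ h = x-y≈0⇒x≈y h
    where
    x-y≈0⇒x≈y : ∀ {x y} → x - y ≈ 0# → x ≈ y
    x-y≈0⇒x≈y {x} {y} h = trans (+-inverseˡ-unique x (- y) h) (-‿involutive y)

  -- Quantified identities and certificates for implications

  data Arity : Set where
    scal vec : Arity

  Abstraction : List Arity → Set → Set
  Abstraction [] A = A
  Abstraction (scal ∷ ks) A = Expr → Abstraction ks A
  Abstraction (vec ∷ ks) A = (Fin 3 → Expr) → Abstraction ks A

  -- Variables are numbered in the order of abstraction, a vector taking three consecutive indices;
  -- `Closed` stacks their values in the same order.
  instantiate : ∀ {A} ks → ℕ → Abstraction ks A → A
  instantiate [] n f = f
  instantiate (scal ∷ ks) n f = instantiate ks (1 ℕ.+ n) (f (var n))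
  instantiate (vec ∷ ks) n f = instantiate ks (3 ℕ.+ n) (f (λ i → var (toℕ i ℕ.+ n)))

  infixr 5 _◃_ _◃ᵥ_

  _◃_ : Carrier → Env → Env
  (x ◃ ρ) zero = x
  (x ◃ ρ) (suc n) = ρ n

  _◃ᵥ_ : (Fin 3 → Carrier) → Env → Env
  x ◃ᵥ ρ = x zero ◃ x (suc zero) ◃ x (suc (suc zero)) ◃ ρ

  level : List Arity → Level
  level [] = ℓ
  level (_ ∷ ks) = c ⊔ level ks

  Closed : ∀ ks → (Env → Set ℓ) → Set (level ks)
  Closed [] G = G (λ _ → 0#)
  Closed (scal ∷ ks) G = ∀ x → Closed ks (λ ρ → G (x ◃ ρ))
  Closed (vec ∷ ks) G = ∀ x → Closed ks (λ ρ → G (x ◃ᵥ ρ))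

  close : ∀ ks {G : Env → Set ℓ} → (∀ ρ → G ρ) → Closed ks G
  close [] g = g _
  close (scal ∷ ks) g x = close ks (λ ρ → g _)
  close (vec ∷ ks) g x = close ks (λ ρ → g _)

  -- The premise is settled by evaluation: a difference that normalises to the empty list has value
  -- `0#` in every environment.
  solve : ∀ ks (f : Abstraction ks Equation) → let e = instantiate ks 0 f in
          normalise false (difference e) ≡ [] → Closed ks (Holds e)
  solve ks f h = close ks λ ρ → zero-difference e ρ
    (trans (sym (normalise-correct ρ false (difference e))) (reflexive (≡.cong (poly ρ) h)))
    where e = instantiate ks 0 f

  -- A hypothesis comes with the coefficient it takes in the linear
  -- combination of the hypotheses that yields the goal.
  Problem : Set
  Problem = Equation × List (Expr × Equation)

  residual : Problem → Expr
  residual (g , []) = difference g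
  residual (g , (k , h) ∷ hs) = residual (g , hs) :- k :* difference h

  Implied : Problem → Env → Set ℓ
  Implied (g , []) ρ = Holds g ρ
  Implied (g , (_ , h) ∷ hs) ρ = Holds h ρ → Implied (g , hs) ρ

  residual-zero : ∀ p ρ → ⟦ residual p ⟧ ρ ≈ 0# → Implied p ρ
  residual-zero (g , []) ρ e = zero-difference g ρ e
  residual-zero (g , (k , h) ∷ hs) ρ e hyp = residual-zero (g , hs) ρ
    (trans (sym (+-identityʳ _)) (trans (+-congˡ (sym vanishes)) e))
    where
    vanishes : - (⟦ k ⟧ ρ * ⟦ difference h ⟧ ρ) ≈ 0#
    vanishes = trans (-‿cong (trans (*-congˡ (difference-zero h ρ hyp)) (zeroʳ _))) -0#≈0#

  combine : ∀ ks (f : Abstraction ks Problem) → let p = instantiate ks 0 f in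
                      normalise false (residual p) ≡ [] → Closed ks (Implied p)
  combine ks f h = close ks λ ρ → residual-zero p ρ
    (trans (sym (normalise-correct ρ false (residual p))) (reflexive (≡.cong (poly ρ) h)))
    where p = instantiate ks 0 f

-- Finite fields and the Frobenius map

module Powers {c ℓ} (F : Field c ℓ) (q : ℕ) where
  open Field F
  open PG F q using (pow)

  pow-cong : ∀ n {x y} → x ≈ y → pow x n ≈ pow y n
  pow-cong zero e = refl
  pow-cong (suc n) e = *-cong e (pow-cong n e)

  pow-1# : ∀ n → pow 1# n ≈ 1#
  pow-1# zero = refl
  pow-1# (suc n) = trans (*-identityˡ _) (pow-1# n)

  pow-* : ∀ n x y → pow (x * y) n ≈ pow x n * pow y n
  pow-* zero x y = sym (*-identityˡ _)
  pow-* (suc n) x y = trans (*-congˡ (pow-* n x y)) (interchange _ _ _ _)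
    where open import Algebra.Properties.CommutativeSemigroup *-commutativeSemigroup

  pow-+ℕ : ∀ m n x → pow x (m ℕ.+ n) ≈ pow x m * pow x n
  pow-+ℕ zero n x = sym (*-identityˡ _)
  pow-+ℕ (suc m) n x = trans (*-congˡ (pow-+ℕ m n x)) (sym (*-assoc _ _ _))

  pow-pow : ∀ m n x → pow (pow x m) n ≈ pow x (m ℕ.* n)
  pow-pow zero n x = pow-1# n
  pow-pow (suc m) n x = trans (pow-* n x (pow x m))
    (trans (*-congˡ (pow-pow m n x)) (sym (pow-+ℕ n (m ℕ.* n) x)))

  FrobeniusAdditive FrobeniusInvolutive : Set (c ⊔ ℓ)
  FrobeniusAdditive = ∀ x y → pow (x + y) q ≈ pow x q + pow y q
  FrobeniusInvolutive = ∀ x → pow (pow x q) q ≈ x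

module FiniteField {c ℓ} (F : Field c ℓ) (_≟_ : Decidable (Field._≈_ F)) where
  open Field F hiding (zero)
  open import Algebra.Properties.Ring ring
  open import Algebra.Properties.Semiring.Mult semiring using (×1-homo-*; ×-assoc-*) renaming (_×_ to _⨰_)
  open import Algebra.Properties.Monoid.Mult +-monoid using (×-congʳ)
  open import Algebra.Properties.CommutativeSemiring.Binomial commutativeSemiring using (binomialTerm; theorem)
  open import Algebra.Properties.Semiring.Exp semiring using (_^_)
  open import Data.List.Membership.Setoid setoid using (_∈_)
  open import Data.List.Relation.Unary.Unique.Setoid setoid using (Unique)
  open UniqueLists setoid
  import Algebra.Properties.CommutativeMonoid.Sum as Sum
  private
    module Σ+ = Sum +-commutativeMonoid
    module Π* = Sum *-commutativeMonoid

  *-cancelˡ-0# : ∀ {x y} → ¬ (x ≈ 0#) → x * y ≈ 0# → y ≈ 0#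
  *-cancelˡ-0# {x} {y} x≉0 xy≈0 = let i , xi≈1 = inverse x x≉0 in
    trans (sym (*-identityˡ y)) (trans (*-congʳ (trans (sym xi≈1) (*-comm x i)))
      (trans (*-assoc i x y) (trans (*-congˡ xy≈0) (zeroʳ i))))

  -- The multiple `(p ^ n) ⨰ 1#` is a product of copies of `p ⨰ 1#`, and a field has no zero
  -- divisors.
  pow-char : ∀ p n → (p ℕ.^ n) ⨰ 1# ≈ 0# → p ⨰ 1# ≈ 0#
  pow-char p zero e = ⊥-elim (0≉1 (trans (sym e) (+-identityʳ 1#)))
  pow-char p (suc n) e with (p ⨰ 1#) ≟ 0#
  ... | yes h = h
  ... | no h = pow-char p n (*-cancelˡ-0# h (trans (sym (×1-homo-* p (p ℕ.^ n))) e))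

  module _ (xs : List Carrier) (xs! : Unique xs) (complete : ∀ x → x ∈ xs) where

    -- Translation by `1#` permutes the field, so the sum of all elements is unchanged when
    -- `length xs` copies of `1#` are added to it.
    length-char : length xs ⨰ 1# ≈ 0#
    length-char = +-cancelˡ (Σ+.sum (lookup xs)) _ _ (trans
      (+-congˡ (sym (Σ+.sum-replicate (length xs))))
      (trans (sym (Σ+.∑-distrib-+ (lookup xs) (λ _ → 1#)))
        (trans (sym (ReindexedSums.sum-reindex +-commutativeMonoid (_+ 1#) (_- 1#) xs! +-congʳ +-congʳ
            (λ _ → complete _) (λ _ → complete _)
            (λ x → trans (+-assoc _ _ _) (trans (+-congˡ (-‿inverseˡ 1#)) (+-identityʳ x)))
            (λ x → trans (+-assoc _ _ _) (trans (+-congˡ (-‿inverseʳ 1#)) (+-identityʳ x)))))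
          (sym (+-identityʳ _)))))

    nonzeros : List Carrier
    nonzeros = filter (λ x → ¬? (x ≟ 0#)) xs

    private
      ≉0-resp : ∀ {x y} → x ≈ y → ¬ (x ≈ 0#) → ¬ (y ≈ 0#)
      ≉0-resp e h h' = h (trans e h')

    ∈-nonzeros : ∀ {x} → ¬ (x ≈ 0#) → x ∈ nonzeros
    ∈-nonzeros {x} = ∈-filter⁺ setoid (λ x → ¬? (x ≟ 0#)) ≉0-resp (complete x)

    nonzeros-≉0 : ∀ {x} → x ∈ nonzeros → ¬ (x ≈ 0#)
    nonzeros-≉0 h = proj₂ (∈-filter⁻ setoid (λ x → ¬? (x ≟ 0#)) ≉0-resp {xs = xs} h)

    nonzeros! : Unique nonzeros
    nonzeros! = filter⁺ setoid (λ x → ¬? (x ≟ 0#)) xs!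

    length-nonzeros : suc (length nonzeros) ≡ length xs
    length-nonzeros = length-unique {0# ∷ nonzeros}
      (All.map (λ h e → h (sym e)) (All.all-filter (λ x → ¬? (x ≟ 0#)) xs) ∷ nonzeros!) xs!
      (λ _ → complete _) (λ {x} _ → member x (x ≟ 0#))
      where
      member : ∀ x → Dec (x ≈ 0#) → x ∈ (0# ∷ nonzeros)
      member x (yes e) = here e
      member x (no h) = there (∈-nonzeros h)

    private
      product : Carrier
      product = Π*.sum (lookup nonzeros)

      product≉0 : ∀ ys → (∀ {x} → x ∈ ys → ¬ (x ≈ 0#)) → ¬ (Π*.sum (lookup ys) ≈ 0#)
      product≉0 [] h e = 0≉1 (sym e)
      product≉0 (y ∷ ys) h e = product≉0 ys (h ∘ there) (*-cancelˡ-0# (h (here refl)) e)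

    module _ (q : ℕ) where
      open PG F q using (pow)
      open Powers F q

      product-replicate : ∀ n a → Π*.sum {n} (λ _ → a) ≈ pow a n
      product-replicate zero a = refl
      product-replicate (suc n) a = *-congˡ (product-replicate n a)

      -- Multiplication by `a` permutes the nonzero elements. Their product is therefore unchanged
      -- by the factor `pow a (length nonzeros)`, and being nonzero it cancels.
      pow-length-nonzeros : ∀ a → ¬ (a ≈ 0#) → pow a (length nonzeros) ≈ 1#
      pow-length-nonzeros a a≉0 = *-cancelʳ-product (trans (sym (trans
        (ReindexedSums.sum-reindex *-commutativeMonoid (a *_) (i *_) nonzeros! *-congˡ *-congˡ
          (λ x∈ → ∈-nonzeros λ e → nonzeros-≉0 x∈ (*-cancelˡ-0# a≉0 e))
          (λ x∈ → ∈-nonzeros λ e → nonzeros-≉0 x∈ (*-cancelˡ-0# i≉0 e))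
          (cancel ai≈1) (cancel (trans (*-comm i a) ai≈1)))
        (trans (Π*.∑-distrib-+ (λ _ → a) (lookup nonzeros)) (*-congʳ (product-replicate (length nonzeros) a)))))
        (sym (*-identityˡ product)))
        where
        i : Carrier
        i = proj₁ (inverse a a≉0)
        ai≈1 : a * i ≈ 1#
        ai≈1 = proj₂ (inverse a a≉0)
        i≉0 : ¬ (i ≈ 0#)
        i≉0 e = 0≉1 (trans (sym (zeroʳ a)) (trans (*-congˡ (sym e)) ai≈1))
        cancel : ∀ {a b} → a * b ≈ 1# → ∀ x → a * (b * x) ≈ x
        cancel e x = trans (sym (*-assoc _ _ _)) (trans (*-congʳ e) (*-identityˡ x))
        *-cancelʳ-product : ∀ {x y} → x * product ≈ y * product → x ≈ y
        *-cancelʳ-product {x} {y} e = let j , Pj≈1 = inverse product (product≉0 nonzeros nonzeros-≉0) in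
          trans (sym (cancelʳ Pj≈1 x)) (trans (*-congʳ e) (cancelʳ Pj≈1 y))
          where
          cancelʳ : ∀ {a b} → a * b ≈ 1# → ∀ x → x * a * b ≈ x
          cancelʳ e x = trans (*-assoc _ _ _) (trans (*-congˡ e) (*-identityʳ x))

      pow-length : ∀ x → pow x (length xs) ≈ x
      pow-length x = ≡.subst (λ n → pow x n ≈ x) length-nonzeros (by-cases (x ≟ 0#))
        where
        by-cases : Dec (x ≈ 0#) → x * pow x (length nonzeros) ≈ x
        by-cases (yes e) = trans (*-congʳ e) (trans (zeroˡ _) (sym e))
        by-cases (no h) = trans (*-congˡ (pow-length-nonzeros x h)) (*-identityʳ x)

  module _ (q : ℕ) where
    open PG F q using (pow)
    open Powers F q

    pow-^ : ∀ x n → pow x n ≈ x ^ n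
    pow-^ x zero = refl
    pow-^ x (suc n) = *-congˡ (pow-^ x n)

    multiple-char : ∀ {p n} → p ⨰ 1# ≈ 0# → p ∣ n → ∀ x → n ⨰ x ≈ 0#
    multiple-char {p} char (divides m ≡.refl) x = trans
      (trans (sym (trans (×-assoc-* (m ℕ.* p) 1# x) (×-congʳ (m ℕ.* p) (*-identityˡ x)))) (*-congʳ (×1-homo-* m p)))
      (trans (*-congʳ (trans (*-congˡ char) (zeroʳ _))) (zeroˡ x))

    -- The inner binomial coefficients vanish modulo p.
    pow-prime-+ : ∀ {p} → Prime p → p ⨰ 1# ≈ 0# → ∀ x y → pow (x + y) p ≈ pow x p + pow y p
    pow-prime-+ {zero} pr = ⊥-elim (ℕ.≢-nonZero⁻¹ 0 {{prime⇒nonZero pr}} ≡.refl)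
    pow-prime-+ {suc r} pr char x y = trans (pow-^ (x + y) (suc r)) (trans (theorem (suc r) x y)
      (trans (+-cong first (trans (Σ+.sum-init-last {r} (λ i → term (suc i)))
          (trans (+-cong inner last-term) (+-identityˡ _))))
        (+-comm _ _)))
      where
      term : Fin (suc (suc r)) → Carrier
      term = binomialTerm x y (suc r)
      first : term zero ≈ pow y (suc r)
      first = trans (+-identityʳ _) (trans (*-identityˡ _) (sym (pow-^ y (suc r))))
      inner : Σ+.sum {r} (λ i → term (suc (inject₁ i))) ≈ 0#
      inner = trans (Σ+.sum-cong-≋ λ i → multiple-char char
          (prime∣binomial {k = suc (toℕ (inject₁ i))} pr (s≤s z≤n)
            (s≤s (≡.subst (_< r) (≡.sym (toℕ-inject₁ i)) (toℕ<n i))))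
          (x ^ suc (toℕ (inject₁ i)) * y ^ (r ∸ toℕ (inject₁ i))))
        (Σ+.sum-replicate-zero r)
      last-term : term (suc (fromℕ r)) ≈ pow x (suc r)
      last-term rewrite toℕ-fromℕ r | nCn≡1 (suc r) | ℕₚ.n∸n≡0 r =
        trans (+-identityʳ _) (trans (*-identityʳ _) (sym (pow-^ x (suc r))))

    pow-prime-power-+ : ∀ {p} → Prime p → p ⨰ 1# ≈ 0# → ∀ n x y →
      pow (x + y) (p ℕ.^ n) ≈ pow x (p ℕ.^ n) + pow y (p ℕ.^ n)
    pow-prime-power-+ pr char zero x y =
      trans (*-identityʳ _) (sym (+-cong (*-identityʳ x) (*-identityʳ y)))
    pow-prime-power-+ {p} pr char (suc n) x y = trans (sym (pow-pow p (p ℕ.^ n) (x + y)))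
      (trans (pow-cong (p ℕ.^ n) (pow-prime-+ pr char x y))
        (trans (pow-prime-power-+ pr char n (pow x p) (pow y p))
          (+-cong (pow-pow p (p ℕ.^ n) x) (pow-pow p (p ℕ.^ n) y))))

  module _ (q : ℕ) (xs : List Carrier) (|xs|≡q² : length xs ≡ q ℕ.* q) (xs! : Unique xs)
    (complete : ∀ x → x ∈ xs) where
    open PG F q using (pow)
    open Powers F q

    -- The field has `q * q = p ^ (suc k + suc k)` elements, so this power of `p` annihilates `1#`;
    -- by `pow-char` already `p` does.
    pow-q-+ : PrimePower q → FrobeniusAdditive
    pow-q-+ (p , k , pr , ≡.refl) = pow-prime-power-+ q pr
      (pow-char p (suc k ℕ.+ suc k) (trans (reflexive (≡.cong (_⨰ 1#)
        (≡.trans (ℕₚ.^-distribˡ-+-* p (suc k) (suc k)) (≡.sym |xs|≡q²)))) (length-char xs xs! complete))) (suc k)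

    pow-q-involutive : FrobeniusInvolutive
    pow-q-involutive x = trans (pow-pow q q x)
      (≡.subst (λ n → pow x n ≈ x) |xs|≡q² (pow-length xs xs! complete q x))

-- Vectors and conics over a field with involution

module Geometry {c ℓ} (F : Field c ℓ) (q : ℕ) (_≟_ : Decidable (Field._≈_ F))
  (frobenius-+ : Powers.FrobeniusAdditive F q) (frobenius-involutive : Powers.FrobeniusInvolutive F q)
  where
  open Field F hiding (zero)
  open PG F q
  open Powers F q using (pow-cong; pow-*)
  open Algebra.Properties.Ring ring using (-0#≈0#)
  open FiniteField F _≟_ using (*-cancelˡ-0#; nonzeros; ∈-nonzeros; nonzeros-≉0; nonzeros!; length-nonzeros)
  open UniqueLists using (length-unique)
  open import Data.List.Membership.Setoid setoid using (_∈_)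

  frobenius : Involution commutativeRing
  frobenius = record
    { bar = λ x → pow x q
    ; bar-cong = pow-cong q
    ; bar-+ = frobenius-+
    ; bar-* = pow-* q
    ; bar-involutive = frobenius-involutive
    }

  open Involution frobenius using (bar; bar-cong; bar-+; bar-*; bar-neg; bar-0#; bar-1#; bar-involutive)
  open InvolutionSolver commutativeRing frobenius using
    (Expr; :0; :1; _:+_; _:*_; :-_; _:-_; conj; _:=_; Equation; scal; vec; Abstraction; solve; combine)

  forall₃ : ∀ {p} {P : Fin 3 → Set p} → P 0F → P 1F → P 2F → ∀ i → P i
  forall₃ x y z 0F = x
  forall₃ x y z 1F = y
  forall₃ x y z 2F = z

  ExprV : Set
  ExprV = Fin 3 → Expr

  :dot : ExprV → ExprV → Expr
  :dot a v = a 0F :* v 0F :+ a 1F :* v 1F :+ a 2F :* v 2F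

  :det3 : ExprV → ExprV → ExprV → Expr
  :det3 a b d = a 0F :* (b 1F :* d 2F :- b 2F :* d 1F)
             :- a 1F :* (b 0F :* d 2F :- b 2F :* d 0F)
             :+ a 2F :* (b 0F :* d 1F :- b 1F :* d 0F)

  _⨯_ : V → V → V
  (a ⨯ b) 0F = a 1F * b 2F - a 2F * b 1F
  (a ⨯ b) 1F = a 2F * b 0F - a 0F * b 2F
  (a ⨯ b) 2F = a 0F * b 1F - a 1F * b 0F

  _:⨯_ : ExprV → ExprV → ExprV
  (a :⨯ b) 0F = a 1F :* b 2F :- a 2F :* b 1F
  (a :⨯ b) 1F = a 2F :* b 0F :- a 0F :* b 2F
  (a :⨯ b) 2F = a 0F :* b 1F :- a 1F :* b 0F

  :lin : Expr → ExprV → Expr → ExprV → ExprV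
  :lin x a y b i = x :* a i :+ y :* b i

  :conjᵥ : ExprV → ExprV
  :conjᵥ a i = conj (a i)

  discriminant : QForm → Carrier
  discriminant Q = (1# + 1# + 1# + 1#) * a * b * cc + f * g * h - a * (f * f) - b * (g * g) - cc * (h * h)
    where open QForm Q

  -- With the vectors read as linear forms this is `c d - e u w`, a member of the pencil of conics
  -- spanned by two line pairs. The mixed coefficients are not halved, in keeping with `evalQ`.
  splitForm : V → V → V → V → Carrier → QForm
  splitForm c d u w e = qform (sq 0F) (sq 1F) (sq 2F) (mix 1F 2F) (mix 0F 2F) (mix 0F 1F)
    where
    sq : Fin 3 → Carrier
    sq i = c i * d i - e * (u i * w i)
    mix : Fin 3 → Fin 3 → Carrier
    mix i j = c i * d j + c j * d i - e * (u i * w j + u j * w i)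

  :discriminant : (a b c f g h : Expr) → Expr
  :discriminant a b c f g h =
    (:1 :+ :1 :+ :1 :+ :1) :* a :* b :* c :+ f :* g :* h :- a :* (f :* f) :- b :* (g :* g) :- c :* (h :* h)

  :splitForm : ∀ {A : Set} → ((a b c f g h : Expr) → A) → (c d u w : ExprV) → Expr → A
  :splitForm k c d u w e = k (sq 0F) (sq 1F) (sq 2F) (mix 1F 2F) (mix 0F 2F) (mix 0F 1F)
    where
    sq : Fin 3 → Expr
    sq i = c i :* d i :- e :* (u i :* w i)
    mix : Fin 3 → Fin 3 → Expr
    mix i j = c i :* d j :+ c j :* d i :- e :* (u i :* w j :+ u j :* w i)

  -- In the coordinates `c`, `u`, `w` the form has only mixed terms, with coefficients `- e`, `k x`
  -- and `- k y`, and its discriminant is their product. The change of coordinates contributes the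
  -- square of the determinant.
  discriminant-splitForm : ∀ c u w k x y e →
    discriminant (splitForm c (λ i → k * (x * w i - y * u i)) u w e)
      ≈ k * k * (x * y) * e * (det3 c u w * det3 c u w)
  discriminant-splitForm = solve (vec ∷ vec ∷ vec ∷ scal ∷ scal ∷ scal ∷ scal ∷ [])
    (λ c u w k x y e → :splitForm :discriminant c (λ i → k :* (x :* w i :- y :* u i)) u w e
       := k :* k :* (x :* y) :* e :* (:det3 c u w :* :det3 c u w)) ≡.refl

  :evalQ : (a b c f g h x y z : Expr) → Expr
  :evalQ a b c f g h x y z =
    a :* (x :* x) :+ b :* (y :* y) :+ c :* (z :* z) :+ f :* (y :* z) :+ g :* (x :* z) :+ h :* (x :* y)

  evalQ-splitForm : ∀ c d u w e z →
    evalQ (splitForm c d u w e) z ≈ dot c z * dot d z - e * (dot u z * dot w z)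
  evalQ-splitForm = solve (vec ∷ vec ∷ vec ∷ vec ∷ scal ∷ vec ∷ [])
    (λ c d u w e z → :splitForm :evalQ c d u w e (z 0F) (z 1F) (z 2F)
       := :dot c z :* :dot d z :- e :* (:dot u z :* :dot w z)) ≡.refl

  *-nonzero : ∀ {x y} → ¬ (x ≈ 0#) → ¬ (y ≈ 0#) → ¬ (x * y ≈ 0#)
  *-nonzero x≉0 y≉0 xy≈0 = y≉0 (*-cancelˡ-0# x≉0 xy≈0)

  private
    :4 : Expr
    :4 = :1 :+ :1 :+ :1 :+ :1

  -- A conic through (n,0,-l), (0,n,-m) and their sum contains the line (l,m,n).
  conic⊇line⇒degenerate : ∀ a b c f g h l m n → ¬ (n ≈ 0#) →
    evalQ (qform a b c f g h) (forall₃ n 0# (- l)) ≈ 0# →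
    evalQ (qform a b c f g h) (forall₃ 0# n (- m)) ≈ 0# →
    evalQ (qform a b c f g h) (forall₃ n n (- l - m)) ≈ 0# →
    discriminant (qform a b c f g h) ≈ 0#
  conic⊇line⇒degenerate a b c f g h l m n n≉0 q₁ q₂ q₃ =
    *-cancelˡ-0# (*-nonzero (*-nonzero n≉0 n≉0) (*-nonzero n≉0 n≉0))
      (combine (scal ∷ scal ∷ scal ∷ scal ∷ scal ∷ scal ∷ scal ∷ scal ∷ scal ∷ [])
        (λ a b c f g h l m n → let
            n² = n :* n
            -- Write q₁, q₂, q₃ for the three values. Then `n² a`, `n² b` and `n² h` equal q₁, q₂
            -- and q₃ - q₁ - q₂ up to terms in `c f g l m n`; for `n² h` that term is `h₀`.
            -- Substituting these in turn into `n² n²` times the discriminant produces the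
            -- coefficients `k₁`, `k₂`, `k₃`.
            h₀ = f :* n :* l :+ g :* n :* m :- (c :* l :* m :+ c :* l :* m)
            k₃ = f :* g :* n² :- c :* (n² :* h :+ h₀)
            k₁ = :4 :* c :* b :* n² :- f :* f :* n² :- k₃
            k₂ = :4 :* c :* (g :* n :* l :- c :* l :* l) :- g :* g :* n² :- k₃
          in (n² :* n² :* :discriminant a b c f g h := :0)
            , (k₁ , :evalQ a b c f g h n :0 (:- l) := :0)
            ∷ (k₂ , :evalQ a b c f g h :0 n (:- m) := :0)
            ∷ (k₃ , :evalQ a b c f g h n n (:- l :- m) := :0) ∷ []) ≡.refl
        a b c f g h l m n q₁ q₂ q₃)

  x-y≈0⇒x≈y : ∀ {x y} → x - y ≈ 0# → x ≈ y
  x-y≈0⇒x≈y {x} {y} = combine (scal ∷ scal ∷ [])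
    (λ x y → (x := y) , (:1 , x :- y := :0) ∷ []) ≡.refl x y

  *-cancelˡ-≉ : ∀ {x y z} → ¬ (x ≈ 0#) → x * y ≈ x * z → y ≈ z
  *-cancelˡ-≉ {x} {y} {z} x≉0 e = x-y≈0⇒x≈y (*-cancelˡ-0# x≉0 (combine (scal ∷ scal ∷ scal ∷ [])
    (λ x y z → (x :* (y :- z) := :0) , (:1 , x :* y := x :* z) ∷ []) ≡.refl x y z e))

  neg-nonzero : ∀ {x} → ¬ (x ≈ 0#) → ¬ (- x ≈ 0#)
  neg-nonzero {x} x≉0 e = x≉0 (combine (scal ∷ [])
    (λ x → (x := :0) , (:- :1 , :- x := :0) ∷ []) ≡.refl x e)

  bar-nonzero : ∀ {x} → ¬ (x ≈ 0#) → ¬ (bar x ≈ 0#)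
  bar-nonzero x≉0 e = x≉0 (trans (sym (bar-involutive _)) (trans (bar-cong e) bar-0#))

  InK? : ∀ x → Dec (InK x)
  InK? x = pow x q ≟ x

  InK-cong : ∀ {x y} → x ≈ y → InK x → InK y
  InK-cong e h = trans (bar-cong (sym e)) (trans h e)

  InK-+ : ∀ {x y} → InK x → InK y → InK (x + y)
  InK-+ hx hy = trans (bar-+ _ _) (+-cong hx hy)

  InK-* : ∀ {x y} → InK x → InK y → InK (x * y)
  InK-* hx hy = trans (bar-* _ _) (*-cong hx hy)

  InK-neg : ∀ {x} → InK x → InK (- x)
  InK-neg hx = trans (bar-neg _) (-‿cong hx)

  InK-sub : ∀ {x y} → InK x → InK y → InK (x - y)
  InK-sub hx hy = InK-+ hx (InK-neg hy)

  InK-norm : ∀ x → InK (x * bar x)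
  InK-norm = solve (scal ∷ []) (λ x → conj (x :* conj x) := x :* conj x) ≡.refl

  InK-trace : ∀ x → InK (x + bar x)
  InK-trace = solve (scal ∷ []) (λ x → conj (x :+ conj x) := x :+ conj x) ≡.refl

  InK-cancel : ∀ {n x} → ¬ (n ≈ 0#) → InK n → InK (n * x) → InK x
  InK-cancel {n} {x} n≉0 hn hnx = *-cancelˡ-≉ n≉0 (combine (scal ∷ scal ∷ [])
    (λ n x → (n :* conj x := n :* x) , (:1 , conj (n :* x) := n :* x) ∷ (:- conj x , conj n := n) ∷ [])
    ≡.refl n x hnx hn)

  norm-nonzero : ∀ {x} → ¬ (x ≈ 0#) → ¬ (x * bar x ≈ 0#)
  norm-nonzero x≉0 = *-nonzero x≉0 (bar-nonzero x≉0)

  infix 4 _≈ᵥ_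
  _≈ᵥ_ : V → V → Set ℓ
  a ≈ᵥ b = ∀ i → a i ≈ b i

  conjᵥ : V → V
  conjᵥ a i = bar (a i)

  zeroᵥ? : (a : V) → (∀ i → a i ≈ 0#) ⊎ (∃ λ i → ¬ (a i ≈ 0#))
  zeroᵥ? a with a 0F ≟ 0# | a 1F ≟ 0# | a 2F ≟ 0#
  ... | no h | _ | _ = inj₂ (0F , h)
  ... | yes _ | no h | _ = inj₂ (1F , h)
  ... | yes _ | yes _ | no h = inj₂ (2F , h)
  ... | yes h₀ | yes h₁ | yes h₂ = inj₁ (forall₃ h₀ h₁ h₂)

  nonzero-coordinate : {a : V} → NonZero a → ∃ λ i → ¬ (a i ≈ 0#)
  nonzero-coordinate {a} a≉0 with zeroᵥ? a
  ... | inj₁ h = ⊥-elim (a≉0 h)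
  ... | inj₂ h = h

  dot-cong : ∀ {a a' b b'} → a ≈ᵥ a' → b ≈ᵥ b' → dot a b ≈ dot a' b'
  dot-cong h k = +-cong (+-cong (*-cong (h 0F) (k 0F)) (*-cong (h 1F) (k 1F))) (*-cong (h 2F) (k 2F))

  dot-zeroˡ : ∀ a b → (∀ i → a i ≈ 0#) → dot a b ≈ 0#
  dot-zeroˡ a b h = trans (dot-cong {a} {λ _ → 0#} {b} h (λ _ → refl))
    (solve (vec ∷ []) (λ b → :dot (λ _ → :0) b := :0) ≡.refl b)

  ⨯-cong : ∀ {a a' b b'} → a ≈ᵥ a' → b ≈ᵥ b' → (a ⨯ b) ≈ᵥ (a' ⨯ b')
  ⨯-cong h k = forall₃ (minor 1F 2F) (minor 2F 0F) (minor 0F 1F)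
    where
    minor = λ i j → +-cong (*-cong (h i) (k j)) (-‿cong (*-cong (h j) (k i)))

  det3-cong : ∀ {a a' b b' d d'} → a ≈ᵥ a' → b ≈ᵥ b' → d ≈ᵥ d' → det3 a b d ≈ det3 a' b' d'
  det3-cong h k m = +-cong (+-cong (*-cong (h 0F) (minor 1F 2F)) (-‿cong (*-cong (h 1F) (minor 0F 2F))))
      (*-cong (h 2F) (minor 0F 1F))
    where
    minor = λ i j → +-cong (*-cong (k i) (m j)) (-‿cong (*-cong (k j) (m i)))

  bar-dot : ∀ a b → bar (dot a b) ≈ dot (conjᵥ a) (conjᵥ b)
  bar-dot = solve (vec ∷ vec ∷ []) (λ a b → conj (:dot a b) := :dot (:conjᵥ a) (:conjᵥ b)) ≡.refl

  InK-dot : ∀ {a b} → InK³ a → InK³ b → InK (dot a b)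
  InK-dot {a} {b} ha hb = trans (bar-dot a b) (dot-cong ha hb)

  bar-⨯ : ∀ a b i → bar ((a ⨯ b) i) ≈ (conjᵥ a ⨯ conjᵥ b) i
  bar-⨯ a b 0F = solve (vec ∷ vec ∷ []) (λ a b → conj ((a :⨯ b) 0F) := (:conjᵥ a :⨯ :conjᵥ b) 0F) ≡.refl a b
  bar-⨯ a b 1F = solve (vec ∷ vec ∷ []) (λ a b → conj ((a :⨯ b) 1F) := (:conjᵥ a :⨯ :conjᵥ b) 1F) ≡.refl a b
  bar-⨯ a b 2F = solve (vec ∷ vec ∷ []) (λ a b → conj ((a :⨯ b) 2F) := (:conjᵥ a :⨯ :conjᵥ b) 2F) ≡.refl a b

  minors : ∀ {a b} → (∀ i → (a ⨯ b) i ≈ 0#) → ∀ i j → a i * b j ≈ a j * b i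
  minors h 0F 0F = refl
  minors h 0F 1F = x-y≈0⇒x≈y (h 2F)
  minors h 0F 2F = sym (x-y≈0⇒x≈y (h 1F))
  minors h 1F 0F = sym (x-y≈0⇒x≈y (h 2F))
  minors h 1F 1F = refl
  minors h 1F 2F = x-y≈0⇒x≈y (h 0F)
  minors h 2F 0F = x-y≈0⇒x≈y (h 1F)
  minors h 2F 1F = sym (x-y≈0⇒x≈y (h 0F))
  minors h 2F 2F = refl

  minors⁻¹ : ∀ {a b} → (∀ i j → a i * b j ≈ a j * b i) → ∀ i → (a ⨯ b) i ≈ 0#
  minors⁻¹ {a} {b} h = forall₃ (vanish 1F 2F) (vanish 2F 0F) (vanish 0F 1F)
    where
    vanish : ∀ i j → a i * b j - a j * b i ≈ 0#
    vanish i j = trans (+-congʳ (h i j)) (-‿inverseʳ _)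

  ∼-refl : ∀ {a} → a ∼ a
  ∼-refl = 1# , (λ e → 0≉1 (sym e)) , λ i → sym (*-identityˡ _)

  ∼-reflexive : ∀ {a b} → a ≈ᵥ b → a ∼ b
  ∼-reflexive h = 1# , (λ e → 0≉1 (sym e)) , λ i → trans (h i) (sym (*-identityˡ _))

  inverse-nonzero : ∀ {x y} → x * y ≈ 1# → ¬ (y ≈ 0#)
  inverse-nonzero xy≈1 y≈0 = 0≉1 (trans (sym (zeroʳ _)) (trans (*-congˡ (sym y≈0)) xy≈1))

  ∼-sym : ∀ {a b} → a ∼ b → b ∼ a
  ∼-sym {a} {b} (k , k≉0 , h) with inverse k k≉0
  ... | j , kj≈1 = j , inverse-nonzero kj≈1 , λ i → combine (scal ∷ scal ∷ scal ∷ scal ∷ [])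
    (λ a b k j → (b := j :* a) , (:- j , a := k :* b) ∷ (:- b , k :* j := :1) ∷ [])
    ≡.refl (a i) (b i) k j (h i) kj≈1

  ∼-trans : ∀ {a b d} → a ∼ b → b ∼ d → a ∼ d
  ∼-trans (k , k≉0 , h) (j , j≉0 , h') =
    k * j , *-nonzero k≉0 j≉0 , λ i → trans (h i) (trans (*-congˡ (h' i)) (sym (*-assoc _ _ _)))

  ⨯≈0⇒∼ : ∀ {a b} → NonZero a → NonZero b → (∀ i → (a ⨯ b) i ≈ 0#) → a ∼ b
  ⨯≈0⇒∼ {a} {b} a≉0 b≉0 h with nonzero-coordinate b≉0
  ... | i , bi≉0 with inverse (b i) bi≉0
  ... | y , biy≈1 = a i * y , k≉0 , a≈kb
    where
    a≈kb : ∀ j → a j ≈ a i * y * b j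
    a≈kb j = combine (scal ∷ scal ∷ scal ∷ scal ∷ scal ∷ [])
      (λ ai aj bi bj y → (aj := ai :* y :* bj) , (:- y , ai :* bj := aj :* bi) ∷ (:- aj , bi :* y := :1) ∷ [])
      ≡.refl (a i) (a j) (b i) (b j) y (minors h i j) biy≈1
    k≉0 : ¬ (a i * y ≈ 0#)
    k≉0 e = a≉0 λ j → trans (a≈kb j) (trans (*-congʳ e) (zeroˡ _))

  ∼⇒⨯≈0 : ∀ {a b} → a ∼ b → ∀ i → (a ⨯ b) i ≈ 0#
  ∼⇒⨯≈0 {a} {b} (k , _ , h) = minors⁻¹ λ i j → combine (scal ∷ scal ∷ scal ∷ scal ∷ scal ∷ [])
    (λ ai aj bi bj k → (ai :* bj := aj :* bi) , (bj , ai := k :* bi) ∷ (:- bi , aj := k :* bj) ∷ [])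
    ≡.refl (a i) (a j) (b i) (b j) k (h i) (h j)

  private
    :dual : Fin 3 → Abstraction (vec ∷ vec ∷ vec ∷ vec ∷ []) Equation
    :dual i = λ n a b d → :det3 a b d :* n i
      := :dot n a :* (b :⨯ d) i :+ :dot n b :* (d :⨯ a) i :+ :dot n d :* (a :⨯ b) i

    :cramer : Fin 3 → Abstraction (vec ∷ vec ∷ vec ∷ vec ∷ []) Equation
    :cramer i = λ w a b d → :det3 a b d :* w i
      := :det3 w b d :* a i :+ :det3 a w d :* b i :+ :det3 a b w :* d i

  -- Up to the factor `det3 a b d`, the three cross products form the basis dual to `a`, `b`, `d`. A
  -- line is thus recovered from its values at three independent points.
  dual-expansion : ∀ n a b d i → det3 a b d * n i
    ≈ dot n a * (b ⨯ d) i + dot n b * (d ⨯ a) i + dot n d * (a ⨯ b) i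
  dual-expansion n a b d 0F = solve (vec ∷ vec ∷ vec ∷ vec ∷ []) (:dual 0F) ≡.refl n a b d
  dual-expansion n a b d 1F = solve (vec ∷ vec ∷ vec ∷ vec ∷ []) (:dual 1F) ≡.refl n a b d
  dual-expansion n a b d 2F = solve (vec ∷ vec ∷ vec ∷ vec ∷ []) (:dual 2F) ≡.refl n a b d

  cramer : ∀ w a b d i → det3 a b d * w i
    ≈ det3 w b d * a i + det3 a w d * b i + det3 a b w * d i
  cramer w a b d 0F = solve (vec ∷ vec ∷ vec ∷ vec ∷ []) (:cramer 0F) ≡.refl w a b d
  cramer w a b d 1F = solve (vec ∷ vec ∷ vec ∷ vec ∷ []) (:cramer 1F) ≡.refl w a b d
  cramer w a b d 2F = solve (vec ∷ vec ∷ vec ∷ vec ∷ []) (:cramer 2F) ≡.refl w a b d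

  dual-expansion₁ : ∀ n a b d → OnLine n a → OnLine n d → ∀ i →
    det3 a b d * n i ≈ dot n b * (d ⨯ a) i
  dual-expansion₁ n a b d ha hd i = combine (scal ∷ scal ∷ scal ∷ scal ∷ scal ∷ scal ∷ scal ∷ [])
    (λ e x y z x' y' z' → (e := y :* y')
      , (:1 , e := x :* x' :+ y :* y' :+ z :* z') ∷ (x' , x := :0) ∷ (z' , z := :0) ∷ [])
    ≡.refl (det3 a b d * n i) (dot n a) (dot n b) (dot n d)
    ((b ⨯ d) i) ((d ⨯ a) i) ((a ⨯ b) i) (dual-expansion n a b d i) ha hd

  ⨯-anticomm : ∀ a b i → (a ⨯ b) i ≈ - (b ⨯ a) i
  ⨯-anticomm a b 0F = solve (vec ∷ vec ∷ []) (λ a b → (a :⨯ b) 0F := :- (b :⨯ a) 0F) ≡.refl a b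
  ⨯-anticomm a b 1F = solve (vec ∷ vec ∷ []) (λ a b → (a :⨯ b) 1F := :- (b :⨯ a) 1F) ≡.refl a b
  ⨯-anticomm a b 2F = solve (vec ∷ vec ∷ []) (λ a b → (a :⨯ b) 2F := :- (b :⨯ a) 2F) ≡.refl a b

  orthogonal-to-three : ∀ n a b d → NonZero n → OnLine n a → OnLine n b → OnLine n d → det3 a b d ≈ 0#
  orthogonal-to-three n a b d n≉0 ha hb hd with det3 a b d ≟ 0#
  ... | yes e = e
  ... | no Δ≉0 = ⊥-elim (n≉0 λ i → *-cancelˡ-0# Δ≉0
      (trans (dual-expansion₁ n a b d ha hd i) (trans (*-congʳ hb) (zeroˡ _))))

  -- After scaling one nonzero coordinate of `p` to `1#`, some coordinate lies outside K, or else
  -- `p` would be proportional to a vector over K. An element outside K is thus obtained without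
  -- counting K.
  outsideK : (p : V) → NonZero p → (∀ w → InK³ w → ¬ (p ∼ w)) → ∃ λ ω → ¬ InK ω
  outsideK p p≉0 p≁K with nonzero-coordinate p≉0
  ... | i , pi≉0 with inverse (p i) pi≉0
  ... | y , piy≈1 with InK? (y * p 0F) | InK? (y * p 1F) | InK? (y * p 2F)
  ... | no h | _ | _ = _ , h
  ... | yes _ | no h | _ = _ , h
  ... | yes _ | yes _ | no h = _ , h
  ... | yes h₀ | yes h₁ | yes h₂ = ⊥-elim (p≁K (λ j → y * p j) (forall₃ h₀ h₁ h₂)
      (p i , pi≉0 , λ j → combine (scal ∷ scal ∷ scal ∷ [])
        (λ x y z → (z := x :* (y :* z)) , (:- z , x :* y := :1) ∷ []) ≡.refl (p i) y (p j) piy≈1))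

  -- The frame formed by the vertex, its conjugate and the tangent point

  module Frame (n p t : V) (n≉0 : NonZero n) (n⊥p : OnLine n p) (n⊥t : OnLine n t)
    (p≉0 : NonZero p) (t≉0 : NonZero t) (p≁t : ¬ (p ∼ t)) (t-real : InK³ t)
    (tangent : ∀ w → InK³ w → NonZero w → OnLine n w → w ∼ t)
    where

    p̄ : V
    p̄ = conjᵥ p

    -- By tangency a real point on `n` is `t`, whereas `p` lies on `n` and differs from `t`.
    p≁K : ∀ w → InK³ w → ¬ (p ∼ w)
    p≁K w w-real p∼w@(k , k≉0 , h) = p≁t (∼-trans p∼w (tangent w w-real w≉0 n⊥w))
      where
      w≉0 : NonZero w
      w≉0 e = p≉0 λ i → trans (h i) (trans (*-congˡ (e i)) (zeroʳ _))
      n⊥w : OnLine n w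
      n⊥w = *-cancelˡ-0# k≉0 (trans (solve (vec ∷ vec ∷ scal ∷ [])
          (λ n w k → k :* :dot n w := :dot n (λ i → k :* w i)) ≡.refl n w k)
        (trans (dot-cong {n} (λ _ → refl) (λ i → sym (h i))) n⊥p))

    ω : Carrier
    ω = proj₁ (outsideK p p≉0 p≁K)

    ω∉K : ¬ InK ω
    ω∉K = proj₂ (outsideK p p≉0 p≁K)

    -- A nonzero skew element, in characteristic 2 as well. It later serves as the normalised value
    -- of `δ`.
    ε : Carrier
    ε = ω - bar ω

    ε≉0 : ¬ (ε ≈ 0#)
    ε≉0 e = ω∉K (sym (x-y≈0⇒x≈y e))

    Δ : Carrier
    Δ = det3 p p̄ t

    p⨯t≉0 : NonZero (p ⨯ t)
    p⨯t≉0 h = p≁t (⨯≈0⇒∼ p≉0 t≉0 h)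

    real-on-n : ∀ w → InK³ w → OnLine n w → ∀ i → (w ⨯ t) i ≈ 0#
    real-on-n w w-real n⊥w with zeroᵥ? w
    ... | inj₁ w≈0 = minors⁻¹ λ i j → trans (trans (*-congʳ (w≈0 i)) (zeroˡ _))
                                        (sym (trans (*-congʳ (w≈0 j)) (zeroˡ _)))
    ... | inj₂ (i , wi≉0) = ∼⇒⨯≈0 (tangent w w-real (λ h → wi≉0 (h i)) n⊥w)

    -- Otherwise p̄ lies on n too, and then so do the real points p + p̄ and
    -- ωp + ω̄p̄; both being multiples of t, so would be p.
    Δ≉0 : ¬ (Δ ≈ 0#)
    Δ≉0 Δ≈0 = p⨯t≉0 p⨯t≈0
      where
      n⊥p̄ : OnLine n p̄
      n⊥p̄ with nonzero-coordinate {p ⨯ t} p⨯t≉0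
      ... | i , h = *-cancelˡ-0# h (combine (scal ∷ scal ∷ scal ∷ scal ∷ [])
          (λ Δ ni np̄ pi → (pi :* np̄ := :0)
             , (:1 , Δ :* ni := np̄ :* (:- pi)) ∷ (:- ni , Δ := :0) ∷ []) ≡.refl
          Δ (n i) (dot n p̄) ((p ⨯ t) i)
          (trans (dual-expansion₁ n p p̄ t n⊥p n⊥t i) (*-congˡ (⨯-anticomm t p i))) Δ≈0)

      combination-on-n : ∀ x y → InK³ (lin x p y p̄) → ∀ i → (lin x p y p̄ ⨯ t) i ≈ 0#
      combination-on-n x y real = real-on-n _ real (combine (vec ∷ vec ∷ vec ∷ scal ∷ scal ∷ [])
        (λ n p p̄ x y → (:dot n (:lin x p y p̄) := :0)
          , (x , :dot n p := :0) ∷ (y , :dot n p̄ := :0) ∷ []) ≡.refl n p p̄ x y n⊥p n⊥p̄)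

      p+p̄ : ∀ i → (lin 1# p 1# p̄ ⨯ t) i ≈ 0#
      p+p̄ = combination-on-n 1# 1# λ i → solve (scal ∷ [])
        (λ x → conj (:1 :* x :+ :1 :* conj x) := :1 :* x :+ :1 :* conj x) ≡.refl (p i)

      ωp+ω̄p̄ : ∀ i → (lin ω p (bar ω) p̄ ⨯ t) i ≈ 0#
      ωp+ω̄p̄ = combination-on-n ω (bar ω) λ i → solve (scal ∷ scal ∷ [])
        (λ ω x → conj (ω :* x :+ conj ω :* conj x) := ω :* x :+ conj ω :* conj x) ≡.refl ω (p i)

      p⨯t≈0 : ∀ i → (p ⨯ t) i ≈ 0#
      p⨯t≈0 = minors⁻¹ λ i j → x-y≈0⇒x≈y (*-cancelˡ-0# ε≉0
        (combine (scal ∷ scal ∷ scal ∷ scal ∷ scal ∷ [])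
          (λ ω pi pj ti tj → ((ω :- conj ω) :* (pi :* tj :- pj :* ti) := :0)
            , (:1 , (ω :* pi :+ conj ω :* conj pi) :* tj := (ω :* pj :+ conj ω :* conj pj) :* ti)
            ∷ (:- conj ω , (:1 :* pi :+ :1 :* conj pi) :* tj := (:1 :* pj :+ :1 :* conj pj) :* ti) ∷ [])
          ≡.refl ω (p i) (p j) (t i) (t j) (minors ωp+ω̄p̄ i j) (minors p+p̄ i j)))

    -- Conjugation interchanges `p` and `p̄` and fixes `t`.
    bar-Δ : bar Δ ≈ - Δ
    bar-Δ = combine (vec ∷ vec ∷ [])
      (λ p t → (conj (:det3 p (:conjᵥ p) t) := :- :det3 p (:conjᵥ p) t)
        , ((:conjᵥ p :⨯ p) 0F , conj (t 0F) := t 0F) ∷ ((:conjᵥ p :⨯ p) 1F , conj (t 1F) := t 1F)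
        ∷ ((:conjᵥ p :⨯ p) 2F , conj (t 2F) := t 2F) ∷ []) ≡.refl p t (t-real 0F) (t-real 1F) (t-real 2F)

    -- For real `w = u p + ū p̄ + r t` the values of `B`, `B̄`, `c₁` are `Δ ū`, `- Δ u` and `ΔΔ r`.
    -- The factor `Δ` in `c₁`, the line joining `p` and `p̄`, compensates for `p ⨯ p̄` being skew.
    B B̄ c₁ : V
    B = t ⨯ p
    B̄ = t ⨯ p̄
    c₁ i = Δ * (p ⨯ p̄) i

    -- A line through `t`. With `β = dot B w`, its value at a real `w` is
    -- `Δ * (bar (b * β) - b * β)`, which vanishes exactly when `b * β` lies in K.
    d : Carrier → V
    d b i = Δ * (bar b * B̄ i - b * B i)

    bar-B : ∀ i → bar (B i) ≈ B̄ i
    bar-B i = trans (bar-⨯ t p i) (⨯-cong t-real (λ _ → refl) i)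

    c₁-real : InK³ c₁
    c₁-real i = combine (scal ∷ scal ∷ scal ∷ [])
      (λ Δ x y → (conj (Δ :* x) := Δ :* x)
        , (conj x , conj Δ := :- Δ) ∷ (:- Δ , conj x := y) ∷ (:- Δ , y := :- x) ∷ []) ≡.refl
      Δ ((p ⨯ p̄) i) ((p̄ ⨯ p) i) bar-Δ
      (trans (bar-⨯ p p̄ i) (⨯-cong {p̄} (λ _ → refl) (λ j → bar-involutive (p j)) i)) (⨯-anticomm p̄ p i)

    d-real : ∀ b → InK³ (d b)
    d-real b i = combine (scal ∷ scal ∷ scal ∷ scal ∷ [])
      (λ Δ b x y → (conj (Δ :* (conj b :* y :- b :* x)) := Δ :* (conj b :* y :- b :* x))
        , (b :* conj y :- conj b :* conj x , conj Δ := :- Δ) ∷ (:- Δ :* b , conj y := x)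
        ∷ (Δ :* conj b , conj x := y) ∷ [])
      ≡.refl Δ b (B i) (B̄ i) bar-Δ
      (trans (bar-cong (sym (bar-B i))) (bar-involutive (B i))) (bar-B i)

    bar-β : ∀ w → InK³ w → bar (dot B w) ≈ dot B̄ w
    bar-β w w-real = trans (bar-dot B w) (dot-cong bar-B w-real)

    c₁⊥p : OnLine c₁ p
    c₁⊥p = solve (vec ∷ vec ∷ scal ∷ [])
      (λ p p̄ Δ → :dot (λ i → Δ :* (p :⨯ p̄) i) p := :0) ≡.refl p p̄ Δ

    c₁-t : dot c₁ t ≈ Δ * Δ
    c₁-t = solve (vec ∷ vec ∷ vec ∷ scal ∷ [])
      (λ p p̄ t Δ → :dot (λ i → Δ :* (p :⨯ p̄) i) t := Δ :* :det3 p p̄ t) ≡.refl p p̄ t Δ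

    ΔΔ : Carrier
    ΔΔ = Δ * Δ

    ΔΔ≉0 : ¬ (ΔΔ ≈ 0#)
    ΔΔ≉0 = *-nonzero Δ≉0 Δ≉0

    c₁≉0 : NonZero c₁
    c₁≉0 e = ΔΔ≉0 (trans (sym c₁-t) (dot-zeroˡ c₁ t e))

    B⊥t : ∀ x → dot (t ⨯ x) t ≈ 0#
    B⊥t x = solve (vec ∷ vec ∷ []) (λ t x → :dot (t :⨯ x) t := :0) ≡.refl t x

    d⊥t : ∀ b → OnLine (d b) t
    d⊥t b = solve (vec ∷ vec ∷ vec ∷ scal ∷ scal ∷ scal ∷ [])
      (λ p p̄ t Δ b b̄ → :dot (λ i → Δ :* (b̄ :* (t :⨯ p̄) i :- b :* (t :⨯ p) i)) t := :0) ≡.refl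
      p p̄ t Δ b (bar b)

    d-p : ∀ b → dot (d b) p ≈ - (ΔΔ * bar b)
    d-p b = solve (vec ∷ vec ∷ vec ∷ scal ∷ scal ∷ scal ∷ [])
      (λ p p̄ t Δ b b̄ → :dot (λ i → Δ :* (b̄ :* (t :⨯ p̄) i :- b :* (t :⨯ p) i)) p
         := :- (Δ :* :det3 p p̄ t :* b̄)) ≡.refl p p̄ t Δ b (bar b)

    d≉0 : ∀ b → ¬ (b ≈ 0#) → NonZero (d b)
    d≉0 b b≉0 e = neg-nonzero (*-nonzero ΔΔ≉0 (bar-nonzero b≉0)) (trans (sym (d-p b)) (dot-zeroˡ (d b) p e))

    δ : Carrier → Carrier → Carrier
    δ a b = a * bar b - bar a * b

    bar-δ : ∀ a b → bar (δ a b) ≈ - δ a b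
    bar-δ = solve (scal ∷ scal ∷ [])
      (λ a b → conj (a :* conj b :- conj a :* b) := :- (a :* conj b :- conj a :* b)) ≡.refl

    -- Modulo p a point w is determined by the affine coordinate z = s/β, with
    -- s = c₁·w and β = B·w, and the line n is z = ∞. A Baer pencil with vertex p
    -- that contains n is an affine K-line { a + kb }; clearing denominators in
    -- (z - a)/b ∈ K gives Cond.
    Cond : Carrier → Carrier → V → Set ℓ
    Cond a b w = InK ((dot c₁ w - a * dot B w) * bar (b * dot B w))

    -- On real points this condition becomes the equation of a K-rational quadratic form.
    form : Carrier → Carrier → V → Carrier
    form a b w = dot c₁ w * dot (d b) w - Δ * δ a b * (dot B w * dot B̄ w)

    -- Write `s = dot c₁ w` and `β = dot B w`. As `s` is real and `bar β = dot B̄ w`, subtracting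
    -- from the expression in `Cond` its conjugate leaves `s (b̄ β̄ - b β) - δ β β̄`, and `form` is
    -- `Δ` times this.
    form-skew : ∀ a b w → InK³ w → form a b w ≈
      Δ * ((dot c₁ w - a * dot B w) * bar (b * dot B w) - bar ((dot c₁ w - a * dot B w) * bar (b * dot B w)))
    form-skew a b w w-real = combine (vec ∷ vec ∷ vec ∷ scal ∷ scal ∷ scal ∷ scal ∷ scal ∷ [])
      (λ w B B̄ Δ s a b β → (s :* :dot (λ i → Δ :* (conj b :* B̄ i :- b :* B i)) w
           :- Δ :* (a :* conj b :- conj a :* b) :* (β :* :dot B̄ w)
         := Δ :* ((s :- a :* β) :* conj (b :* β) :- conj ((s :- a :* β) :* conj (b :* β))))
        , (Δ :* b :* β , conj s := s)
        ∷ (:- (Δ :* s :* conj b) :+ Δ :* (a :* conj b :- conj a :* b) :* β , conj β := :dot B̄ w)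
        ∷ (Δ :* s :* b , β := :dot B w) ∷ []) ≡.refl
      w B B̄ Δ (dot c₁ w) a b (dot B w) (InK-dot {c₁} {w} c₁-real w-real) (bar-β w w-real) refl

    Cond⇒form : ∀ a b w → InK³ w → Cond a b w → form a b w ≈ 0#
    Cond⇒form a b w w-real h = trans (form-skew a b w w-real)
      (trans (*-congˡ (trans (+-congˡ (-‿cong h)) (-‿inverseʳ _))) (zeroʳ _))

    form⇒Cond : ∀ a b w → InK³ w → form a b w ≈ 0# → Cond a b w
    form⇒Cond a b w w-real h =
      sym (x-y≈0⇒x≈y (*-cancelˡ-0# Δ≉0 (trans (sym (form-skew a b w w-real)) h)))

    -- The two K-memberships say that the affine K-lines have the same direction and that `a'` lies
    -- on the first; they are quotients by `b'` and `b` with denominators cleared by norms.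
    Cond-transfer : ∀ {a b a' b'} → ¬ (b ≈ 0#) → InK (b * bar b') → InK ((a - a') * bar b) →
      ∀ w → Cond a b w → Cond a' b' w
    Cond-transfer {a} {b} {a'} {b'} b≉0 hb ha w h = InK-cancel (norm-nonzero b≉0) (InK-norm b)
      (InK-cong (sym (identity _ _ _ _ _ _)) (InK-* hb (InK-+ h (InK-* ha (InK-norm (dot B w))))))
      where
      identity : ∀ s β a b a' b' → b * bar b * ((s - a' * β) * bar (b' * β))
        ≈ b * bar b' * ((s - a * β) * bar (b * β) + (a - a') * bar b * (β * bar β))
      identity = solve (scal ∷ scal ∷ scal ∷ scal ∷ scal ∷ scal ∷ [])
        (λ s β a b a' b' → b :* conj b :* ((s :- a' :* β) :* conj (b' :* β))
          := b :* conj b' :* ((s :- a :* β) :* conj (b :* β) :+ (a :- a') :* conj b :* (β :* conj β))) ≡.refl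

    Cond-transfer⁻¹ : ∀ {a b a' b'} → ¬ (b ≈ 0#) → ¬ (b' ≈ 0#) → InK (b * bar b') → InK ((a - a') * bar b) →
      ∀ w → Cond a' b' w → Cond a b w
    Cond-transfer⁻¹ {a} {b} {a'} {b'} b≉0 b'≉0 hb ha = Cond-transfer b'≉0
      (InK-cong (solve (scal ∷ scal ∷ []) (λ b b' → conj (b :* conj b') := b' :* conj b) ≡.refl b b')
        (bar-cong hb))
      (InK-cancel (norm-nonzero b≉0) (InK-norm b) (InK-cong
        (solve (scal ∷ scal ∷ scal ∷ scal ∷ []) (λ a b a' b' →
           :- ((a :- a') :* conj b :* (b :* conj b')) := b :* conj b :* ((a' :- a) :* conj b')) ≡.refl a b a' b')
        (InK-neg (InK-* ha hb))))

  NonZero-∼ : ∀ {a b} → a ∼ b → NonZero a → NonZero b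
  NonZero-∼ (k , _ , e) a≉0 h = a≉0 λ i → trans (e i) (trans (*-congˡ (h i)) (zeroʳ _))

  dot-scale : ∀ a k b → dot a (λ i → k * b i) ≈ k * dot a b
  dot-scale = solve (vec ∷ scal ∷ vec ∷ []) (λ a k b → :dot a (λ i → k :* b i) := k :* :dot a b) ≡.refl

  OnLine-∼ : ∀ n {a b} → a ∼ b → OnLine n a → OnLine n b
  OnLine-∼ n {a} {b} (k , k≉0 , e) h = *-cancelˡ-0# k≉0
    (trans (sym (dot-scale n k b)) (trans (dot-cong {n} (λ _ → refl) (λ i → sym (e i))) h))

  OnLine-cong : ∀ n {a b} → a ≈ᵥ b → OnLine n a → OnLine n b
  OnLine-cong n {a} {b} h e = trans (dot-cong {n} {n} {b} {a} (λ _ → refl) (λ i → sym (h i))) e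

  -- The change of coordinates by `M`, and pencils in terms of determinants

  module Coordinates (M : Matrix) (detM≉0 : Nonsingular M) where
    m₀ m₁ m₂ : V
    m₀ = M 0F
    m₁ = M 1F
    m₂ = M 2F

    d⁻¹ : Carrier
    d⁻¹ = proj₁ (inverse (det M) detM≉0)

    det*d⁻¹ : det M * d⁻¹ ≈ 1#
    det*d⁻¹ = proj₂ (inverse (det M) detM≉0)

    adj : V → V
    adj v i = (m₁ ⨯ m₂) i * v 0F + (m₂ ⨯ m₀) i * v 1F + (m₀ ⨯ m₁) i * v 2F

    :adj : ExprV → ExprV → ExprV → ExprV → ExprV
    :adj m₀ m₁ m₂ v i = (m₁ :⨯ m₂) i :* v 0F :+ (m₂ :⨯ m₀) i :* v 1F :+ (m₀ :⨯ m₁) i :* v 2F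

    :apply : ExprV → ExprV → ExprV → ExprV → ExprV
    :apply m₀ m₁ m₂ v 0F = :dot m₀ v
    :apply m₀ m₁ m₂ v 1F = :dot m₁ v
    :apply m₀ m₁ m₂ v 2F = :dot m₂ v

    N : V → V
    N v i = d⁻¹ * adj v i

    apply-adj : ∀ v i → apply M (adj v) i ≈ det M * v i
    apply-adj v 0F = solve (vec ∷ vec ∷ vec ∷ vec ∷ [])
      (λ m₀ m₁ m₂ v → :dot m₀ (:adj m₀ m₁ m₂ v) := :det3 m₀ m₁ m₂ :* v 0F) ≡.refl m₀ m₁ m₂ v
    apply-adj v 1F = solve (vec ∷ vec ∷ vec ∷ vec ∷ [])
      (λ m₀ m₁ m₂ v → :dot m₁ (:adj m₀ m₁ m₂ v) := :det3 m₀ m₁ m₂ :* v 1F) ≡.refl m₀ m₁ m₂ v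
    apply-adj v 2F = solve (vec ∷ vec ∷ vec ∷ vec ∷ [])
      (λ m₀ m₁ m₂ v → :dot m₂ (:adj m₀ m₁ m₂ v) := :det3 m₀ m₁ m₂ :* v 2F) ≡.refl m₀ m₁ m₂ v

    adj-apply : ∀ w i → adj (apply M w) i ≈ det M * w i
    adj-apply w 0F = solve (vec ∷ vec ∷ vec ∷ vec ∷ [])
      (λ m₀ m₁ m₂ w → :adj m₀ m₁ m₂ (:apply m₀ m₁ m₂ w) 0F := :det3 m₀ m₁ m₂ :* w 0F) ≡.refl m₀ m₁ m₂ w
    adj-apply w 1F = solve (vec ∷ vec ∷ vec ∷ vec ∷ [])
      (λ m₀ m₁ m₂ w → :adj m₀ m₁ m₂ (:apply m₀ m₁ m₂ w) 1F := :det3 m₀ m₁ m₂ :* w 1F) ≡.refl m₀ m₁ m₂ w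
    adj-apply w 2F = solve (vec ∷ vec ∷ vec ∷ vec ∷ [])
      (λ m₀ m₁ m₂ w → :adj m₀ m₁ m₂ (:apply m₀ m₁ m₂ w) 2F := :det3 m₀ m₁ m₂ :* w 2F) ≡.refl m₀ m₁ m₂ w

    d⁻¹-cancel : ∀ x → d⁻¹ * (det M * x) ≈ x
    d⁻¹-cancel x = combine (scal ∷ scal ∷ scal ∷ [])
      (λ D i x → (i :* (D :* x) := x) , (x , D :* i := :1) ∷ []) ≡.refl (det M) d⁻¹ x det*d⁻¹

    apply-N : ∀ v → v ≈ᵥ apply M (N v)
    apply-N v i = sym (trans (dot-scale (M i) d⁻¹ (adj v)) (trans (*-congˡ (apply-adj v i)) (d⁻¹-cancel (v i))))

    apply-cong : ∀ {u w} → u ≈ᵥ w → apply M u ≈ᵥ apply M w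
    apply-cong h i = dot-cong {M i} (λ _ → refl) h

    apply-∼ : ∀ {u w} → u ∼ w → apply M u ∼ apply M w
    apply-∼ {u} {w} (k , k≉0 , h) = k , k≉0 , λ i → trans (apply-cong h i) (dot-scale (M i) k w)

    apply-∼⁻¹ : ∀ {u w} → apply M u ∼ apply M w → u ∼ w
    apply-∼⁻¹ {u} {w} (k , k≉0 , h) = k , k≉0 , λ i → *-cancelˡ-≉ detM≉0
      (trans (sym (adj-apply u i)) (trans (+-cong (+-cong (*-congˡ (h 0F)) (*-congˡ (h 1F))) (*-congˡ (h 2F)))
        (trans (solve (scal ∷ vec ∷ vec ∷ []) (λ k a b →
            a 0F :* (k :* b 0F) :+ a 1F :* (k :* b 1F) :+ a 2F :* (k :* b 2F)
              := k :* (a 0F :* b 0F :+ a 1F :* b 1F :+ a 2F :* b 2F)) ≡.refl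
            k (forall₃ ((m₁ ⨯ m₂) i) ((m₂ ⨯ m₀) i) ((m₀ ⨯ m₁) i)) (apply M w))
          (trans (*-congˡ (adj-apply w i)) (x∙yz≈y∙xz _ _ _)))))
      where open import Algebra.Properties.CommutativeSemigroup *-commutativeSemigroup

    apply-NonZero : ∀ {w} → NonZero w → NonZero (apply M w)
    apply-NonZero {w} w≉0 h = w≉0 λ i → *-cancelˡ-0# detM≉0 (trans (sym (adj-apply w i))
      (combine (scal ∷ scal ∷ scal ∷ vec ∷ [])
        (λ x y z b → (x :* b 0F :+ y :* b 1F :+ z :* b 2F := :0)
          , (x , b 0F := :0) ∷ (y , b 1F := :0) ∷ (z , b 2F := :0) ∷ []) ≡.refl
        ((m₁ ⨯ m₂) i) ((m₂ ⨯ m₀) i) ((m₀ ⨯ m₁) i) (apply M w) (h 0F) (h 1F) (h 2F)))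

    NonZero-apply : ∀ {v w} → v ∼ apply M w → NonZero v → NonZero w
    NonZero-apply {v} {w} v∼Mw v≉0 w≈0 = NonZero-∼ v∼Mw v≉0
      λ i → trans (apply-cong w≈0 i) (solve (vec ∷ []) (λ a → :dot a (λ _ → :0) := :0) ≡.refl (M i))

    det3-apply : ∀ x y z → det3 (apply M x) (apply M y) (apply M z) ≈ det M * det3 x y z
    det3-apply x y z = solve (vec ∷ vec ∷ vec ∷ vec ∷ vec ∷ vec ∷ []) (λ m₀ m₁ m₂ x y z →
        :det3 (:apply m₀ m₁ m₂ x) (:apply m₀ m₁ m₂ y) (:apply m₀ m₁ m₂ z)
          := :det3 m₀ m₁ m₂ :* :det3 x y z) ≡.refl m₀ m₁ m₂ x y z

    pullback : V → V
    pullback l j = l 0F * m₀ j + l 1F * m₁ j + l 2F * m₂ j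

    :pullback : ExprV → ExprV → ExprV → ExprV → ExprV
    :pullback m₀ m₁ m₂ l j = l 0F :* m₀ j :+ l 1F :* m₁ j :+ l 2F :* m₂ j

    dot-pullback : ∀ l w → dot (pullback l) w ≈ dot l (apply M w)
    dot-pullback l w = solve (vec ∷ vec ∷ vec ∷ vec ∷ vec ∷ []) (λ m₀ m₁ m₂ l w →
      :dot (:pullback m₀ m₁ m₂ l) w := :dot l (:apply m₀ m₁ m₂ w)) ≡.refl m₀ m₁ m₂ l w

    -- Pairing the row vector `l M` with the columns of the adjugate of `M` returns the entries of
    -- `l` times `det M`.
    pullback-NonZero : ∀ {l} → NonZero l → NonZero (pullback l)
    pullback-NonZero {l} l≉0 h = l≉0 (forall₃
      (*-cancelˡ-0# detM≉0 (trans (sym (solve (vec ∷ vec ∷ vec ∷ vec ∷ []) (λ m₀ m₁ m₂ l →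
         :dot (:pullback m₀ m₁ m₂ l) (m₁ :⨯ m₂) := :det3 m₀ m₁ m₂ :* l 0F) ≡.refl m₀ m₁ m₂ l))
         (dot-zeroˡ _ (m₁ ⨯ m₂) h)))
      (*-cancelˡ-0# detM≉0 (trans (sym (solve (vec ∷ vec ∷ vec ∷ vec ∷ []) (λ m₀ m₁ m₂ l →
         :dot (:pullback m₀ m₁ m₂ l) (m₂ :⨯ m₀) := :det3 m₀ m₁ m₂ :* l 1F) ≡.refl m₀ m₁ m₂ l))
         (dot-zeroˡ _ (m₂ ⨯ m₀) h)))
      (*-cancelˡ-0# detM≉0 (trans (sym (solve (vec ∷ vec ∷ vec ∷ vec ∷ []) (λ m₀ m₁ m₂ l →
         :dot (:pullback m₀ m₁ m₂ l) (m₀ :⨯ m₁) := :det3 m₀ m₁ m₂ :* l 2F) ≡.refl m₀ m₁ m₂ l))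
         (dot-zeroˡ _ (m₀ ⨯ m₁) h))))

    module _ (P p X x Y y : V) (P≈Mp : P ≈ᵥ apply M p) (X≈Mx : X ≈ᵥ apply M x) (Y≈My : Y ≈ᵥ apply M y)
      (D≉0 : ¬ (det3 p x y ≈ 0#)) {v w : V} (v∼Mw : v ∼ apply M w) (w≉0 : NonZero w) where

      apply-combination : ∀ e b k m → apply M (lin e p b (lin k x m y)) ≈ᵥ lin e P b (lin k X m Y)
      apply-combination e b k m i = trans
        (solve (vec ∷ vec ∷ vec ∷ vec ∷ scal ∷ scal ∷ scal ∷ scal ∷ [])
          (λ a p x y e b k m → :dot a (:lin e p b (:lin k x m y))
             := e :* :dot a p :+ b :* (k :* :dot a x :+ m :* :dot a y)) ≡.refl (M i) p x y e b k m)
        (+-cong (*-congˡ (sym (P≈Mp i)))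
          (*-congˡ (+-cong (*-congˡ (sym (X≈Mx i))) (*-congˡ (sym (Y≈My i))))))

      -- By Cramer's rule `det3 p w y` and `det3 p x w` are, up to a common factor, the coefficients
      -- of `x` and `y` in `w` modulo `p`. On the pencil they are a common multiple `ρ` of `k` and
      -- `m` in K, and the product with the conjugate becomes a norm times `k * m`.
      Pencil⇒InK : Pencil P X Y v → InK (det3 p w y * bar (det3 p x w))
      Pencil⇒InK (Z , (k , m , k-real , m-real , _ , (j , j≉0 , hZ)) , e , b , _ , v∼Z) =
        InK-cong (sym product) (InK-* (InK-norm _) (InK-* k-real m-real))
        where
        w∼ : w ∼ lin e p (b * j) (lin k x m y)
        w∼ = apply-∼⁻¹ (∼-trans (∼-sym v∼Mw) (∼-trans v∼Z (∼-reflexive λ i → sym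
          (trans (apply-combination e (b * j) k m i)
            (+-congˡ (trans (*-assoc _ _ _) (*-congˡ (sym (hZ i)))))))))
        r D : Carrier
        r = proj₁ w∼
        D = det3 p x y
        hw : w ≈ᵥ λ i → r * lin e p (b * j) (lin k x m y) i
        hw = proj₂ (proj₂ w∼)
        γ₁ : det3 p w y ≈ r * (b * j) * D * k
        γ₁ = trans (det3-cong {p} {p} {w} {_} {y} (λ _ → refl) hw (λ _ → refl))
          (solve (vec ∷ vec ∷ vec ∷ scal ∷ scal ∷ scal ∷ scal ∷ scal ∷ []) (λ p x y r e b k m →
            :det3 p (λ i → r :* :lin e p b (:lin k x m y) i) y := r :* b :* :det3 p x y :* k) ≡.refl
            p x y r e (b * j) k m)
        γ₂ : det3 p x w ≈ r * (b * j) * D * m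
        γ₂ = trans (det3-cong {p} {p} {x} (λ _ → refl) (λ _ → refl) hw)
          (solve (vec ∷ vec ∷ vec ∷ scal ∷ scal ∷ scal ∷ scal ∷ scal ∷ []) (λ p x y r e b k m →
            :det3 p x (λ i → r :* :lin e p b (:lin k x m y) i) := r :* b :* :det3 p x y :* m) ≡.refl
            p x y r e (b * j) k m)
        ρ : Carrier
        ρ = r * (b * j) * D
        product : det3 p w y * bar (det3 p x w) ≈ ρ * bar ρ * (k * m)
        product = trans (*-cong γ₁ (trans (bar-cong γ₂) (trans (bar-* _ _) (*-congˡ m-real))))
          (solve (scal ∷ scal ∷ scal ∷ scal ∷ []) (λ ρ ρ̄ k m → ρ :* k :* (ρ̄ :* m) := ρ :* ρ̄ :* (k :* m)) ≡.refl
            ρ (bar ρ) k m)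

      -- Cramer's rule also gives the coefficient of the vertex, `e = det3 w x y`. Were `e` and `b`
      -- both zero, then `w` would be.
      pencil-point : ∀ b k m → InK k → InK m → ¬ (k ≈ 0# × m ≈ 0#) →
        det3 p w y ≈ b * k → det3 p x w ≈ b * m → Pencil P X Y v
      pencil-point b k m k-real m-real k,m≉0 hk hm =
        lin k X m Y , (k , m , k-real , m-real , k,m≉0 , ∼-refl) , e , b , e,b≉0 , ∼-trans v∼Mw Mw∼
        where
        D e : Carrier
        D = det3 p x y
        e = det3 w x y
        hw : ∀ i → D * w i ≈ lin e p b (lin k x m y) i
        hw i = trans (cramer w p x y i) (trans (+-cong (+-congˡ (*-congʳ hk)) (*-congʳ hm))
          (solve (scal ∷ scal ∷ scal ∷ scal ∷ scal ∷ scal ∷ scal ∷ []) (λ e p b k x m y →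
            e :* p :+ b :* k :* x :+ b :* m :* y := e :* p :+ b :* (k :* x :+ m :* y)) ≡.refl
            e (p i) b k (x i) m (y i)))
        e,b≉0 : ¬ (e ≈ 0# × b ≈ 0#)
        e,b≉0 (e≈0 , b≈0) = w≉0 λ i → *-cancelˡ-0# D≉0 (trans (hw i)
          (trans (+-cong (trans (*-congʳ e≈0) (zeroˡ _)) (trans (*-congʳ b≈0) (zeroˡ _))) (+-identityˡ _)))
        Mw∼ : apply M w ∼ lin e P b (lin k X m Y)
        Mw∼ = ∼-sym (D , D≉0 , λ i → trans (sym (apply-combination e b k m i))
          (trans (sym (apply-cong hw i)) (dot-scale (M i) D w)))

      InK⇒Pencil : InK (det3 p w y * bar (det3 p x w)) → Pencil P X Y v
      InK⇒Pencil h with det3 p x w ≟ 0#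
      -- Here `w` lies on the line joining `p` to `x`, so the base point is `x` itself; this
      -- includes the case that `w` is the vertex.
      ... | yes e = pencil-point (det3 p w y) 1# 0# bar-1# bar-0# (λ h → 0≉1 (sym (proj₁ h)))
          (sym (*-identityʳ _)) (trans e (sym (zeroʳ _)))
      ... | no γ₂≉0 with inverse (det3 p x w) γ₂≉0
      -- The base point is `k x + y` with `k = γ₁ / γ₂`, which lies in K because `γ₁ * bar γ₂` does.
      ... | i , γ₂i≈1 = pencil-point γ₂ (γ₁ * i) 1#
          (InK-cancel (norm-nonzero γ₂≉0) (InK-norm γ₂) (InK-cong (combine (scal ∷ scal ∷ scal ∷ [])
            (λ γ₁ γ₂ i → (γ₁ :* conj γ₂ := γ₂ :* conj γ₂ :* (γ₁ :* i))
              , (:- γ₁ :* conj γ₂ , γ₂ :* i := :1) ∷ []) ≡.refl γ₁ γ₂ i γ₂i≈1) h))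
          bar-1# (λ h → 0≉1 (sym (proj₂ h)))
          (combine (scal ∷ scal ∷ scal ∷ []) (λ γ₁ γ₂ i → (γ₁ := γ₂ :* (γ₁ :* i))
              , (:- γ₁ , γ₂ :* i := :1) ∷ []) ≡.refl γ₁ γ₂ i γ₂i≈1)
          (sym (*-identityʳ _))
        where
        γ₁ γ₂ : Carrier
        γ₁ = det3 p w y
        γ₂ = det3 p x w

  -- The number of elements of K

  module Skew (ω : Carrier) (ω∉K : ¬ InK ω) where

    ε≉0 : ¬ (ω - bar ω ≈ 0#)
    ε≉0 e = ω∉K (sym (x-y≈0⇒x≈y e))

    -- Both `k` and `ω * k` being real forces `(ω - bar ω) * k` to vanish.
    ωK∩K : ∀ {k} → InK k → InK (ω * k) → k ≈ 0#
    ωK∩K {k} hk hωk = *-cancelˡ-0# ε≉0 (combine (scal ∷ scal ∷ [])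
      (λ ω k → ((ω :- conj ω) :* k := :0)
        , (:- :1 , conj (ω :* k) := ω :* k) ∷ (conj ω , conj k := k) ∷ []) ≡.refl ω k hωk hk)

    module _ (xs : List Carrier) (xs! : AllPairs (λ a b → ¬ (a ≈ b)) xs) (complete : ∀ x → x ∈ xs) where

      Ks : List Carrier
      Ks = filter InK? xs

      ∈-Ks : ∀ {x} → InK x → x ∈ Ks
      ∈-Ks {x} = ∈-filter⁺ setoid InK? InK-cong (complete x)

      Ks-real : All InK Ks
      Ks-real = All.all-filter InK? xs

      Ks! : AllPairs (λ a b → ¬ (a ≈ b)) Ks
      Ks! = filter⁺ setoid InK? xs!

      private
        ε⁻¹ : ∃ λ i → (ω - bar ω) * i ≈ 1#
        ε⁻¹ = inverse _ ε≉0

        -- Coordinates in the basis `1#`, `ω` of F over K: subtracting its conjugate from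
        -- `x = re + im ω` leaves `x - bar x = im (ω - bar ω)`.
        im re : Carrier → Carrier
        im x = (x - bar x) * proj₁ ε⁻¹
        re x = x - im x * ω

        im-spec : ∀ x → (ω - bar ω) * im x ≈ x - bar x
        im-spec x = combine (scal ∷ scal ∷ scal ∷ [])
          (λ e y i → (e :* (y :* i) := y) , (y , e :* i := :1) ∷ []) ≡.refl
          (ω - bar ω) (x - bar x) (proj₁ ε⁻¹) (proj₂ ε⁻¹)

        im-real : ∀ x → InK (im x)
        im-real x = *-cancelˡ-≉ ε≉0 (combine (scal ∷ scal ∷ scal ∷ [])
          (λ ω x y → ((ω :- conj ω) :* conj y := (ω :- conj ω) :* y)
            , (:- :1 , conj ((ω :- conj ω) :* y) := conj (x :- conj x))
            ∷ (:- :1 , (ω :- conj ω) :* y := x :- conj x) ∷ []) ≡.refl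
          ω x (im x) (bar-cong (im-spec x)) (im-spec x))

        re-real : ∀ x → InK (re x)
        re-real x = combine (scal ∷ scal ∷ scal ∷ [])
          (λ ω x y → (conj (x :- y :* ω) := x :- y :* ω)
            , (:- conj ω , conj y := y) ∷ (:1 , (ω :- conj ω) :* y := x :- conj x) ∷ []) ≡.refl
          ω x (im x) (im-real x) (im-spec x)

        Pairs : Setoid _ _
        Pairs = setoid ×ₛ setoid

        coordinates : Carrier → Carrier × Carrier
        coordinates x = re x , im x

        open import Data.List.Membership.Setoid Pairs using () renaming (_∈_ to _∈²_)

        coordinates-injective : ∀ {x y} → re x ≈ re y × im x ≈ im y → x ≈ y
        coordinates-injective {x} {y} (hr , hi) = combine (scal ∷ scal ∷ scal ∷ scal ∷ scal ∷ [])
          (λ ω x y ix iy → (x := y) , (:1 , x :- ix :* ω := y :- iy :* ω) ∷ (ω , ix := iy) ∷ []) ≡.refl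
          ω x y (im x) (im y) hr hi

        im-of : ∀ {a b} → InK a → InK b → ∀ {x} → x ≈ a + b * ω → b ≈ im x
        im-of {a} {b} ha hb {x} e = *-cancelˡ-≉ ε≉0 (trans (combine (scal ∷ scal ∷ scal ∷ scal ∷ [])
          (λ ω a b x → ((ω :- conj ω) :* b := x :- conj x)
            , (:- :1 , x := a :+ b :* ω) ∷ (:1 , conj x := conj (a :+ b :* ω))
            ∷ (:1 , conj a := a) ∷ (conj ω , conj b := b) ∷ []) ≡.refl ω a b x e (bar-cong e) ha hb)
          (sym (im-spec x)))

        pairs⊆coordinates : ∀ {z} → z ∈² cartesianProduct Ks Ks → z ∈² map coordinates xs
        pairs⊆coordinates {a , b} h = Any.map⁺ (Any.map same (complete (a + b * ω)))
          where
          real : ∀ {x} → x ∈ Ks → InK x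
          real x∈ = proj₂ (∈-filter⁻ setoid InK? InK-cong {xs = xs} x∈)
          a∈ : a ∈ Ks × b ∈ Ks
          a∈ = ∈-cartesianProduct⁻ setoid setoid Ks Ks h
          same : ∀ {x} → a + b * ω ≈ x → a ≈ re x × b ≈ im x
          same {x} e = combine (scal ∷ scal ∷ scal ∷ scal ∷ scal ∷ [])
              (λ ω a b x ix → (a := x :- ix :* ω) , (:1 , a :+ b :* ω := x) ∷ (:- ω , b := ix) ∷ []) ≡.refl
              ω a b x (im x) e b≈
            , b≈
            where
            b≈ : b ≈ im x
            b≈ = im-of (real (proj₁ a∈)) (real (proj₂ a∈)) (sym e)

        coordinates⊆pairs : ∀ {z} → z ∈² map coordinates xs → z ∈² cartesianProduct Ks Ks
        coordinates⊆pairs {a , b} h = let x , _ , a≈ , b≈ = ∈-map⁻ setoid Pairs h in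
          ∈-cartesianProduct⁺ setoid setoid (∈-Ks (InK-cong (sym a≈) (re-real x)))
            (∈-Ks (InK-cong (sym b≈) (im-real x)))

        square-injective : ∀ m n → m ℕ.* m ≡ n ℕ.* n → m ≡ n
        square-injective m n e with ℕₚ.<-cmp m n
        ... | tri< m<n _ _ = ⊥-elim (ℕₚ.<-irrefl e (ℕₚ.*-mono-< m<n m<n))
        ... | tri≈ _ m≡n _ = m≡n
        ... | tri> _ _ n<m = ⊥-elim (ℕₚ.<-irrefl (≡.sym e) (ℕₚ.*-mono-< n<m n<m))

      -- The coordinates with respect to `1#` and `ω` match F with K × K, so the square of the
      -- number of elements of K is `q * q`.
      length-Ks : length xs ≡ q ℕ.* q → length Ks ≡ q
      length-Ks e = square-injective _ _ (≡.trans (≡.sym (length-cartesianProduct Ks Ks))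
        (≡.trans (length-unique Pairs (cartesianProduct⁺ setoid setoid Ks! Ks!)
            (map⁺ setoid Pairs coordinates-injective xs!) pairs⊆coordinates coordinates⊆pairs)
          (≡.trans (length-map coordinates xs) e)))

  -- A total inverse, so that `shift` can be a plain function on F; the list it is mapped over
  -- contains only nonzero elements, where the default is never reached.
  inverse-or-0# : ∀ x → Dec (x ≈ 0#) → Carrier
  inverse-or-0# x (yes _) = 0#
  inverse-or-0# x (no x≉0) = proj₁ (inverse x x≉0)

  *-inverse-or-0# : ∀ {x} → ¬ (x ≈ 0#) → ∀ d → x * inverse-or-0# x d ≈ 1#
  *-inverse-or-0# x≉0 (yes e) = ⊥-elim (x≉0 e)
  *-inverse-or-0# x≉0 (no h) = proj₂ (inverse _ h)

  AllPairs-refine : ∀ {a p r s} {A : Set a} {P : A → Set p} {R : A → A → Set r} {S : A → A → Set s} →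
    (∀ {x y} → P x → P y → R x y → S x y) → ∀ {xs} → All P xs → AllPairs R xs → AllPairs S xs
  AllPairs-refine f [] [] = []
  AllPairs-refine f (px ∷ pxs) (rx ∷ rxs) =
    All.map (λ (py , r) → f px py r) (All.zip (pxs , rx)) ∷ AllPairs-refine f pxs rxs

  Pencil-swap : ∀ P X Y {v} → Pencil P X Y v → Pencil P Y X v
  Pencil-swap P X Y (Z , (k , m , k-real , m-real , k,m≉0 , j , j≉0 , h) , rest) =
    Z , (m , k , m-real , k-real , (λ (m≈0 , k≈0) → k,m≉0 (k≈0 , m≈0)) , j , j≉0 ,
      λ i → trans (h i) (*-congˡ (+-comm _ _))) , rest

  -- Multiply the first relation by the conjugate of the second; the signs cancel, and `r` passes
  -- through the conjugation because it lies in K.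
  proportional-norms : ∀ e x y r k x' y' → InK r → e * x ≈ - (k * x') → e * y - r * (e * x) ≈ - (k * y') →
    e * bar e * (x * bar y - r * (x * bar x)) ≈ k * bar k * (x' * bar y')
  proportional-norms e x y r k x' y' r-real ex≈ ey≈ =
    combine (scal ∷ scal ∷ scal ∷ scal ∷ scal ∷ scal ∷ scal ∷ [])
      (λ e x y r k x' y' →
        (e :* conj e :* (x :* conj y :- r :* (x :* conj x)) := k :* conj k :* (x' :* conj y'))
        , (e :* x :* conj (e :* x) , conj r := r)
        ∷ (conj (e :* y :- r :* (e :* x)) , e :* x := :- (k :* x'))
        ∷ (:- (k :* x') , conj (e :* y :- r :* (e :* x)) := conj (:- (k :* y'))) ∷ []) ≡.refl
      e x y r k x' y' r-real ex≈ (bar-cong ey≈)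

  -- Pencils as affine K-lines

  module Configuration (M : Matrix) (detM≉0 : Nonsingular M) (l P T n p t : V)
    (n-pullback : ∀ w → dot n w ≈ dot l (apply M w)) (n≉0 : NonZero n)
    (P≉0 : NonZero P) (l⊥P : OnLine l P) (P≈Mp : ∀ i → P i ≈ apply M p i)
    (t-real : InK³ t) (t≉0 : NonZero t) (T∼Mt : T ∼ apply M t)
    (n⊥p : OnLine n p) (n⊥t : OnLine n t) (p≉0 : NonZero p) (p≁t : ¬ (p ∼ t))
    (tangent : ∀ w → InK³ w → NonZero w → OnLine n w → w ∼ t)
    where

    open Coordinates M detM≉0
    open Frame n p t n≉0 n⊥p n⊥t p≉0 t≉0 p≁t t-real tangent

    -- `S` is the union of the lines through the vertex that belong to the affine K-line `a + K b`,
    -- together with l. The vectors `w` range over all of F, since the comparison of two pencils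
    -- tests points outside the subplane.
    Represents : Carrier → Carrier → PointSet → Set L
    Represents a b S = ∀ v w → v ∼ apply M w → NonZero w → (S v → Cond a b w) × (Cond a b w → S v)

    -- The determinant with p is the determinant of the coordinates (β , s).
    plücker : ∀ x y → ΔΔ * det3 p x y ≈ dot B x * dot c₁ y - dot c₁ x * dot B y
    plücker x y = solve (vec ∷ vec ∷ vec ∷ vec ∷ vec ∷ scal ∷ []) (λ p p̄ t x y Δ →
      Δ :* :det3 p p̄ t :* :det3 p x y
        := :dot (t :⨯ p) x :* :dot (λ i → Δ :* (p :⨯ p̄) i) y
           :- :dot (λ i → Δ :* (p :⨯ p̄) i) x :* :dot (t :⨯ p) y) ≡.refl p p̄ t x y Δ

    -- The coordinates (β , s) of these points are `(0 , b ΔΔ)` and `(ΔΔ , a ΔΔ)`. Hence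
    -- `k x[ b ] + m y[ a ]` lies over `a + (k / m) b`, and over infinity, that is on `n`, when `m`
    -- is zero.
    x[_] y[_] : Carrier → V
    x[ b ] i = b * t i
    y[ a ] i = Δ * p̄ i + a * t i

    B-y : ∀ a → dot B y[ a ] ≈ ΔΔ
    B-y a = solve (vec ∷ vec ∷ vec ∷ scal ∷ scal ∷ []) (λ p p̄ t Δ a →
      :dot (t :⨯ p) (λ i → Δ :* p̄ i :+ a :* t i) := Δ :* :det3 p p̄ t) ≡.refl p p̄ t Δ a

    c₁-y : ∀ a → dot c₁ y[ a ] ≈ a * ΔΔ
    c₁-y a = solve (vec ∷ vec ∷ vec ∷ scal ∷ scal ∷ []) (λ p p̄ t Δ a →
      :dot (λ i → Δ :* (p :⨯ p̄) i) (λ i → Δ :* p̄ i :+ a :* t i) := a :* (Δ :* :det3 p p̄ t)) ≡.refl p p̄ t Δ a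

    B-x : ∀ b → dot B x[ b ] ≈ 0#
    B-x b = trans (dot-scale B b t) (trans (*-congˡ (B⊥t p)) (zeroʳ _))

    c₁-x : ∀ b → dot c₁ x[ b ] ≈ b * ΔΔ
    c₁-x b = trans (dot-scale c₁ b t) (*-congˡ c₁-t)

    det3-canonical : ∀ a b → det3 p x[ b ] y[ a ] ≈ - (b * ΔΔ)
    det3-canonical a b = *-cancelˡ-≉ ΔΔ≉0 (trans (plücker x[ b ] y[ a ])
      (trans (+-cong (*-congʳ (B-x b)) (-‿cong (*-cong (c₁-x b) (B-y a))))
        (solve (scal ∷ scal ∷ scal ∷ []) (λ b e k → :0 :* k :- b :* e :* e := e :* :- (b :* e)) ≡.refl
          b ΔΔ (dot c₁ y[ a ]))))

    X[_] Y[_] : Carrier → V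
    X[ b ] = apply M x[ b ]
    Y[ a ] = apply M y[ a ]

    det3-canonical≉0 : ∀ a {b} → ¬ (b ≈ 0#) → ¬ (det3 p x[ b ] y[ a ] ≈ 0#)
    det3-canonical≉0 a b≉0 e = neg-nonzero (*-nonzero b≉0 ΔΔ≉0) (trans (sym (det3-canonical a _)) e)

    canonical-LinfPencil : ∀ a {b} → ¬ (b ≈ 0#) → LinfPencil l P X[ b ] Y[ a ]
    canonical-LinfPencil a {b} b≉0 =
      (λ e → *-nonzero detM≉0 (det3-canonical≉0 a b≉0) (trans (sym (det3-apply p x[ b ] y[ a ]))
        (trans (det3-cong {apply M p} {P} {X[ b ]} {X[ b ]} {Y[ a ]} {Y[ a ]}
          (λ i → sym (P≈Mp i)) (λ _ → refl) (λ _ → refl)) e)))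
      , P≉0 , l⊥P , X[ b ] , (1# , 0# , bar-1# , bar-0# , (λ h → 0≉1 (sym (proj₁ h))) , ∼-reflexive (λ i →
        solve (scal ∷ scal ∷ []) (λ x y → x := :1 :* x :+ :0 :* y) ≡.refl (X[ b ] i) (Y[ a ] i)))
      , trans (sym (n-pullback x[ b ])) (trans (dot-scale n b t) (trans (*-congˡ n⊥t) (zeroʳ _)))

    -- By `plücker` the two determinants of the pencil criterion are `- (s - a β)` and `- (b β)`, so
    -- the criterion becomes `Cond`, up to the norm of `ΔΔ`.
    canonical-Represents : ∀ a {b} → ¬ (b ≈ 0#) → Represents a b (Pencil P X[ b ] Y[ a ])
    canonical-Represents a {b} b≉0 v w v∼Mw w≉0 =
      (λ h → InK-cancel ΔΔΔΔ≉0 ΔΔΔΔ-real (InK-cong product (InK-* ΔΔΔΔ-real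
        (Pencil⇒InK P p X[ b ] x[ b ] Y[ a ] y[ a ] P≈Mp X≈ Y≈ D≉0 v∼Mw w≉0 h))))
      , λ h → InK⇒Pencil P p X[ b ] x[ b ] Y[ a ] y[ a ] P≈Mp X≈ Y≈ D≉0 v∼Mw w≉0
          (InK-cancel ΔΔΔΔ≉0 ΔΔΔΔ-real (InK-cong (sym product) (InK-* ΔΔΔΔ-real h)))
      where
      X≈ : X[ b ] ≈ᵥ X[ b ]
      X≈ _ = refl
      Y≈ : Y[ a ] ≈ᵥ Y[ a ]
      Y≈ _ = refl
      D≉0 : ¬ (det3 p x[ b ] y[ a ] ≈ 0#)
      D≉0 = det3-canonical≉0 a b≉0
      ΔΔΔΔ≉0 : ¬ (ΔΔ * bar ΔΔ ≈ 0#)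
      ΔΔΔΔ≉0 = norm-nonzero ΔΔ≉0
      ΔΔΔΔ-real : InK (ΔΔ * bar ΔΔ)
      ΔΔΔΔ-real = InK-norm ΔΔ
      product : ΔΔ * bar ΔΔ * (det3 p w y[ a ] * bar (det3 p x[ b ] w))
        ≈ ΔΔ * bar ΔΔ * ((dot c₁ w - a * dot B w) * bar (b * dot B w))
      product = combine (scal ∷ scal ∷ scal ∷ scal ∷ scal ∷ scal ∷ scal ∷ [])
        (λ e a b s β γ₁ γ₂ → (e :* conj e :* (γ₁ :* conj γ₂) := e :* conj e :* ((s :- a :* β) :* conj (b :* β)))
          , (conj (e :* γ₂) , e :* γ₁ := β :* (a :* e) :- s :* e)
          ∷ (:- (s :- a :* β) :* e , conj (e :* γ₂) := conj (:0 :* s :- (b :* e) :* β)) ∷ []) ≡.refl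
        ΔΔ a b (dot c₁ w) (dot B w) (det3 p w y[ a ]) (det3 p x[ b ] w)
        (trans (plücker w y[ a ]) (+-cong (*-congˡ (c₁-y a)) (-‿cong (*-congˡ (B-y a)))))
        (bar-cong (trans (plücker x[ b ] w) (+-cong (*-congʳ (B-x b)) (-‿cong (*-congʳ (c₁-x b))))))

    -- The base meets `n` in `k x + m y`, so over K it is generated by `y` and `x + r y` with
    -- `r = m / k`. The second generator lies on `n` and gives the direction `b = (sx + r sy) / βy`;
    -- the first gives the point `a = sy / βy`.
    module Representative (X Y x y : V) (X≈Mx : ∀ i → X i ≈ apply M x i) (Y≈My : ∀ i → Y i ≈ apply M y i)
      (D≉0 : ¬ (det3 p x y ≈ 0#)) (k m : Carrier) (k-real : InK k) (m-real : InK m)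
      (n⊥z : OnLine n (lin k x m y)) (i : Carrier) (ki≈1 : k * i ≈ 1#) where

      private
        r βx βy sx sy : Carrier
        r = m * i
        βx = dot B x
        βy = dot B y
        sx = dot c₁ x
        sy = dot c₁ y

      r-real : InK r
      r-real = InK-* m-real
        (InK-cancel (inverse-nonzero (trans (*-comm i k) ki≈1)) k-real (InK-cong (sym ki≈1) bar-1#))

      -- The points `p`, `t` and `k x + m y` all lie on `n`, so their determinant vanishes.
      β-relation : βx ≈ - (r * βy)
      β-relation = combine (scal ∷ scal ∷ scal ∷ scal ∷ scal ∷ [])
        (λ βx βy k m i → (βx := :- (m :* i :* βy))
          , (:- i , :- (k :* βx :+ m :* βy) := :0) ∷ (:- βx , k :* i := :1) ∷ []) ≡.refl βx βy k m i
        (trans (solve (vec ∷ vec ∷ vec ∷ vec ∷ scal ∷ scal ∷ []) (λ p t x y k m →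
            :- (k :* :dot (t :⨯ p) x :+ m :* :dot (t :⨯ p) y) := :det3 p t (:lin k x m y)) ≡.refl p t x y k m)
          (orthogonal-to-three n p t (lin k x m y) n≉0 n⊥p n⊥t n⊥z)) ki≈1

      βy≉0 : ¬ (βy ≈ 0#)
      βy≉0 βy≈0 = *-nonzero ΔΔ≉0 D≉0 (trans (plücker x y) (combine (scal ∷ scal ∷ scal ∷ scal ∷ scal ∷ [])
        (λ βx βy sx sy r → (βx :* sy :- sx :* βy := :0)
          , (sy , βx := :- (r :* βy)) ∷ (:- sx :- r :* sy , βy := :0) ∷ []) ≡.refl βx βy sx sy r β-relation βy≈0))

      module _ (a b : Carrier) (aβy : a * βy ≈ sy) (bβy : b * βy ≈ sx + r * sy) where

        b≉0 : ¬ (b ≈ 0#)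
        b≉0 b≈0 = *-nonzero ΔΔ≉0 D≉0 (trans (plücker x y) (combine (scal ∷ scal ∷ scal ∷ scal ∷ scal ∷ scal ∷ [])
          (λ βx βy sx sy r b → (βx :* sy :- sx :* βy := :0)
            , (sy , βx := :- (r :* βy)) ∷ (βy , b :* βy := sx :+ r :* sy) ∷ (:- βy :* βy , b := :0) ∷ []) ≡.refl
          βx βy sx sy r b β-relation bβy b≈0))

        module _ (w : V) where
          private
            γ₁ γ₂ s β : Carrier
            γ₁ = det3 p w y
            γ₂ = det3 p x w
            s = dot c₁ w
            β = dot B w

          eγ₁ : ΔΔ * γ₁ ≈ - (βy * (s - a * β))
          eγ₁ = combine (scal ∷ scal ∷ scal ∷ scal ∷ scal ∷ scal ∷ [])
            (λ eγ₁ s β a βy sy → (eγ₁ := :- (βy :* (s :- a :* β)))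
              , (:1 , eγ₁ := β :* sy :- s :* βy) ∷ (:- β , a :* βy := sy) ∷ []) ≡.refl
            (ΔΔ * γ₁) s β a βy sy (plücker w y) aβy

          -- `γ₂ - r * γ₁` is the determinant of `p`, `x + r y` and `w`. Passing from `γ₂` to it
          -- changes `γ₁ * bar γ₂` by `r` times a norm, which is an element of K.
          eγ₂ : ΔΔ * γ₂ - r * (ΔΔ * γ₁) ≈ - (βy * (b * β))
          eγ₂ = combine (scal ∷ scal ∷ scal ∷ scal ∷ scal ∷ scal ∷ scal ∷ scal ∷ scal ∷ scal ∷ [])
            (λ eγ₁ eγ₂ s β b βx βy sx sy r → (eγ₂ :- r :* eγ₁ := :- (βy :* (b :* β)))
              , (:- r , eγ₁ := β :* sy :- s :* βy) ∷ (:1 , eγ₂ := βx :* s :- sx :* β)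
              ∷ (s , βx := :- (r :* βy)) ∷ (β , b :* βy := sx :+ r :* sy) ∷ []) ≡.refl
            (ΔΔ * γ₁) (ΔΔ * γ₂) s β b βx βy sx sy r (plücker w y) (plücker x w) β-relation bβy

          conditions-agree : ΔΔ * bar ΔΔ * (γ₁ * bar γ₂ - r * (γ₁ * bar γ₁))
            ≈ βy * bar βy * ((s - a * β) * bar (b * β))
          conditions-agree = proportional-norms ΔΔ γ₁ γ₂ r βy (s - a * β) (b * β) r-real eγ₁ eγ₂

          InK⇒Cond : InK (γ₁ * bar γ₂) → Cond a b w
          InK⇒Cond h = InK-cancel (norm-nonzero βy≉0) (InK-norm βy) (InK-cong conditions-agree
            (InK-* (InK-norm ΔΔ) (InK-sub h (InK-* r-real (InK-norm γ₁)))))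

          Cond⇒InK : Cond a b w → InK (γ₁ * bar γ₂)
          Cond⇒InK h = InK-cong
            (solve (scal ∷ scal ∷ []) (λ x y → x :- y :+ y := x) ≡.refl (γ₁ * bar γ₂) (r * (γ₁ * bar γ₁)))
            (InK-+ (InK-cancel (norm-nonzero ΔΔ≉0) (InK-norm ΔΔ) (InK-cong (sym conditions-agree)
              (InK-* (InK-norm βy) h))) (InK-* r-real (InK-norm γ₁)))

        represents : Represents a b (Pencil P X Y)
        represents v w v∼Mw w≉0 =
            (λ h → InK⇒Cond w (Pencil⇒InK P p X x Y y P≈Mp X≈Mx Y≈My D≉0 v∼Mw w≉0 h))
          , λ h → InK⇒Pencil P p X x Y y P≈Mp X≈Mx Y≈My D≉0 v∼Mw w≉0 (Cond⇒InK w h)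

      represent₀ : ∃₂ λ a b → ¬ (b ≈ 0#) × Represents a b (Pencil P X Y)
      represent₀ = normalised (inverse βy βy≉0)
        where
        normalised : (∃ λ j → βy * j ≈ 1#) → ∃₂ λ a b → ¬ (b ≈ 0#) × Represents a b (Pencil P X Y)
        normalised (j , βyj≈1) = sy * j , (sx + r * sy) * j , b≉0 _ _ (scale sy) (scale (sx + r * sy))
            , represents _ _ (scale sy) (scale (sx + r * sy))
          where
          scale : ∀ s → s * j * βy ≈ s
          scale s = combine (scal ∷ scal ∷ scal ∷ [])
            (λ s β j → (s :* j :* β := s) , (s , β :* j := :1) ∷ []) ≡.refl s βy j βyj≈1

    represent₁ : ∀ X Y → ¬ (det3 P X Y ≈ 0#) → ∀ k m → InK k → InK m → ¬ (k ≈ 0#) →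
      OnLine l (lin k X m Y) → ∃₂ λ a b → ¬ (b ≈ 0#) × Represents a b (Pencil P X Y)
    represent₁ X Y D'≉0 k m k-real m-real k≉0 l⊥Z =
      pullback-of (N X) (N Y) (apply-N X) (apply-N Y) (inverse k k≉0)
      where
      pullback-of : ∀ x y → (∀ i → X i ≈ apply M x i) → (∀ i → Y i ≈ apply M y i) → (∃ λ i → k * i ≈ 1#) →
        ∃₂ λ a b → ¬ (b ≈ 0#) × Represents a b (Pencil P X Y)
      pullback-of x y X≈Mx Y≈My (i , ki≈1) =
        Representative.represent₀ X Y x y X≈Mx Y≈My D≉0 k m k-real m-real n⊥z i ki≈1
        where
        D≉0 : ¬ (det3 p x y ≈ 0#)
        D≉0 e = D'≉0 (trans (det3-cong {P} {apply M p} {X} {apply M x} {Y} {apply M y} P≈Mp X≈Mx Y≈My)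
          (trans (det3-apply p x y) (trans (*-congˡ e) (zeroʳ _))))
        n⊥z : OnLine n (lin k x m y)
        n⊥z = trans (n-pullback (lin k x m y)) (OnLine-cong l (λ i → trans
          (+-cong (*-congˡ (X≈Mx i)) (*-congˡ (Y≈My i)))
          (solve (vec ∷ vec ∷ vec ∷ scal ∷ scal ∷ []) (λ a x y k m →
            k :* :dot a x :+ m :* :dot a y := :dot a (:lin k x m y)) ≡.refl (M i) x y k m)) l⊥Z)

    represent : ∀ X Y → LinfPencil l P X Y → ∃₂ λ a b → ¬ (b ≈ 0#) × Represents a b (Pencil P X Y)
    represent X Y (D≉0 , _ , _ , Z , (k , m , k-real , m-real , k,m≉0 , Z∼) , l⊥Z) = by-cases (k ≟ 0#)
      where
      swapped : (∃₂ λ a b → ¬ (b ≈ 0#) × Represents a b (Pencil P Y X)) →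
        ∃₂ λ a b → ¬ (b ≈ 0#) × Represents a b (Pencil P X Y)
      swapped (a , b , b≉0 , rep) = a , b , b≉0 , λ v w v∼Mw w≉0 →
          (λ h → proj₁ (rep v w v∼Mw w≉0) (Pencil-swap P X Y h))
        , λ h → Pencil-swap P Y X (proj₂ (rep v w v∼Mw w≉0) h)
      by-cases : Dec (k ≈ 0#) → ∃₂ λ a b → ¬ (b ≈ 0#) × Represents a b (Pencil P X Y)
      by-cases (no k≉0) = represent₁ X Y D≉0 k m k-real m-real k≉0 (OnLine-∼ l Z∼ l⊥Z)
      by-cases (yes k≈0) = swapped (represent₁ Y X
        (λ e → D≉0 (trans (solve (vec ∷ vec ∷ vec ∷ []) (λ P X Y → :det3 P X Y := :- :det3 P Y X) ≡.refl P X Y)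
          (trans (-‿cong e) -0#≈0#)))
        m k m-real k-real (λ m≈0 → k,m≉0 (k≈0 , m≈0))
        (OnLine-cong l {lin k X m Y} {lin m Y k X} (λ i → +-comm (k * X i) (m * Y i)) (OnLine-∼ l Z∼ l⊥Z)))

    equivalent⇒≐ : ∀ {a b a' b' S S'} → Represents a b S → Represents a' b' S' → ¬ (b ≈ 0#) → ¬ (b' ≈ 0#) →
      InK (b * bar b') → InK ((a - a') * bar b) → S ≐ S'
    equivalent⇒≐ rep rep' b≉0 b'≉0 hb ha v v≉0 =
        (λ h → proj₂ (rep' v (N v) v∼ w≉0) (Cond-transfer b≉0 hb ha (N v) (proj₁ (rep v (N v) v∼ w≉0) h)))
      , λ h → proj₂ (rep v (N v) v∼ w≉0) (Cond-transfer⁻¹ b≉0 b'≉0 hb ha (N v) (proj₁ (rep' v (N v) v∼ w≉0) h))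
      where
      v∼ : v ∼ apply M (N v)
      v∼ = ∼-reflexive (apply-N v)
      w≉0 : NonZero (N v)
      w≉0 = NonZero-apply v∼ v≉0

    Cond-y : ∀ a b e → (dot c₁ y[ e ] - a * dot B y[ e ]) * bar (b * dot B y[ e ])
      ≈ ΔΔ * bar ΔΔ * ((e - a) * bar b)
    Cond-y a b e = trans (*-cong (+-cong (c₁-y e) (-‿cong (*-congˡ (B-y e)))) (bar-cong (*-congˡ (B-y e))))
      (solve (scal ∷ scal ∷ scal ∷ scal ∷ []) (λ a b e d →
        (e :* d :- a :* d) :* conj (b :* d) := d :* conj d :* ((e :- a) :* conj b)) ≡.refl a b e ΔΔ)

    y≉0 : ∀ a → NonZero y[ a ]
    y≉0 a h = ΔΔ≉0 (trans (sym (B-y a)) (trans (dot-cong {B} (λ _ → refl) h)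
      (solve (vec ∷ []) (λ a → :dot a (λ _ → :0) := :0) ≡.refl B)))

    -- Test the equality on the points with β = Δ² and s = eΔ² for e = a and e = a + b.
    ≐⇒equivalent : ∀ {a b a' b' S S'} → Represents a b S → Represents a' b' S' → S ≐ S' →
      InK (b * bar b') × InK ((a - a') * bar b')
    ≐⇒equivalent {a} {b} {a'} {b'} {S} {S'} rep rep' S≐S' =
        InK-cong (solve (scal ∷ scal ∷ scal ∷ scal ∷ []) (λ a b a' b' →
          (a :+ b :- a') :* conj b' :- (a :- a') :* conj b' := b :* conj b') ≡.refl a b a' b')
          (InK-sub (transfer (a + b) (InK-cong (solve (scal ∷ scal ∷ []) (λ a b →
            b :* conj b := (a :+ b :- a) :* conj b) ≡.refl a b) (InK-norm b))) at-a)
      , at-a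
      where
      transfer : ∀ e → InK ((e - a) * bar b) → InK ((e - a') * bar b')
      transfer e h = InK-cancel (norm-nonzero ΔΔ≉0) (InK-norm ΔΔ) (InK-cong (Cond-y a' b' e)
        (proj₁ (rep' Y[ e ] y[ e ] ∼-refl (y≉0 e)) (proj₁ (S≐S' Y[ e ] (apply-NonZero (y≉0 e)))
          (proj₂ (rep Y[ e ] y[ e ] ∼-refl (y≉0 e))
            (InK-cong (sym (Cond-y a b e)) (InK-* (InK-norm ΔΔ) h))))))
      at-a : InK ((a - a') * bar b')
      at-a = transfer a (InK-cong (solve (scal ∷ scal ∷ []) (λ a b → :0 := (a :- a) :* conj b) ≡.refl a b) bar-0#)

    -- The sections with the subplane: conics and pairs of lines

    Q : Carrier → Carrier → QForm
    Q a b = splitForm c₁ (d b) B B̄ (Δ * δ a b)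

    Δδ-real : ∀ a b → InK (Δ * δ a b)
    Δδ-real a b = combine (scal ∷ scal ∷ [])
      (λ Δ δ → (conj (Δ :* δ) := Δ :* δ) , (conj δ , conj Δ := :- Δ) ∷ (:- Δ , conj δ := :- δ) ∷ []) ≡.refl
      Δ (δ a b) bar-Δ (bar-δ a b)

    Q-real : ∀ a b → let open QForm (Q a b) renaming (a to a′; b to b′) in
      InK a′ × InK b′ × InK cc × InK f × InK g × InK h
    Q-real a b = sq 0F , sq 1F , sq 2F , mix 1F 2F , mix 0F 2F , mix 0F 1F
      where
      sq : ∀ i → InK (c₁ i * d b i - Δ * δ a b * (B i * B̄ i))
      sq i = InK-sub (InK-* (c₁-real i) (d-real b i))
        (InK-* (Δδ-real a b) (InK-cong (*-congˡ (bar-B i)) (InK-norm (B i))))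
      mix : ∀ i j → InK (c₁ i * d b j + c₁ j * d b i - Δ * δ a b * (B i * B̄ j + B j * B̄ i))
      mix i j = InK-sub (InK-+ (InK-* (c₁-real i) (d-real b j)) (InK-* (c₁-real j) (d-real b i)))
        (InK-* (Δδ-real a b) (InK-cong (trans (solve (scal ∷ scal ∷ [])
            (λ x y → x :* conj y :+ conj (x :* conj y) := x :* conj y :+ y :* conj x) ≡.refl (B i) (B j))
            (+-cong (*-congˡ (bar-B j)) (*-congˡ (bar-B i)))) (InK-trace (B i * bar (B j)))))

    det3-c₁BB̄ : det3 c₁ B B̄ ≈ ΔΔ * Δ
    det3-c₁BB̄ = solve (vec ∷ vec ∷ vec ∷ scal ∷ []) (λ p p̄ t Δ →
      :det3 (λ i → Δ :* (p :⨯ p̄) i) (t :⨯ p) (t :⨯ p̄) := Δ :* :det3 p p̄ t :* :det3 p p̄ t) ≡.refl p p̄ t Δ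

    -- The discriminant is `ΔΔ * (bar b * b) * (Δ * δ a b)` times the square of
    -- `det3 c₁ B B̄ = ΔΔ * Δ`, a product of nonzero factors.
    Q-nondegenerate : ∀ {a b} → ¬ (b ≈ 0#) → ¬ (δ a b ≈ 0#) → ¬ (discriminant (Q a b) ≈ 0#)
    Q-nondegenerate {a} {b} b≉0 δ≉0 e = *-nonzero (*-nonzero (*-nonzero ΔΔ≉0 (*-nonzero (bar-nonzero b≉0) b≉0))
        (*-nonzero Δ≉0 δ≉0)) (*-nonzero det≉0 det≉0)
      (trans (sym (discriminant-splitForm c₁ B B̄ Δ (bar b) b (Δ * δ a b))) e)
      where
      det≉0 : ¬ (det3 c₁ B B̄ ≈ 0#)
      det≉0 h = *-nonzero ΔΔ≉0 Δ≉0 (trans (sym det3-c₁BB̄) h)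

    form-t : ∀ a b → form a b t ≈ 0#
    form-t a b = combine (scal ∷ scal ∷ scal ∷ scal ∷ scal ∷ [])
      (λ s d e β β̄ → (s :* d :- e :* (β :* β̄) := :0) , (s , d := :0) ∷ (:- (e :* β̄) , β := :0) ∷ []) ≡.refl
      (dot c₁ t) (dot (d b) t) (Δ * δ a b) (dot B t) (dot B̄ t) (d⊥t b) (B⊥t p)

    type1 : ∀ {a b S} → ¬ (b ≈ 0#) → ¬ (δ a b ≈ 0#) → Represents a b S → Type1 M T S
    type1 {a} {b} b≉0 δ≉0 rep = Q a b , (Q-real a b , Q-nondegenerate b≉0 δ≉0)
      , (t , t-real , t≉0 , trans (evalQ-form t) (form-t a b) , T∼Mt)
      , λ v v≉0 →
          (λ (Sv , w , w-real , w≉0 , v∼) → w , w-real , w≉0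
             , trans (evalQ-form w) (Cond⇒form a b w w-real (proj₁ (rep v w v∼ w≉0) Sv)) , v∼)
        , (λ (w , w-real , w≉0 , Qw , v∼) →
             proj₂ (rep v w v∼ w≉0) (form⇒Cond a b w w-real (trans (sym (evalQ-form w)) Qw))
             , w , w-real , w≉0 , v∼)
      where
      evalQ-form : ∀ w → evalQ (Q a b) w ≈ form a b w
      evalQ-form = evalQ-splitForm c₁ (d b) B B̄ (Δ * δ a b)

    -- For `δ a b = 0` the form factors into `c₁` and `d b`. The line `c₂` is compared with `d b`
    -- only through common vanishing, so that both `d b` itself and a given multiple of it can be
    -- used.
    type2With : ∀ {a b S} → δ a b ≈ 0# → Represents a b S → (c₂ : V) → KLine c₂ → OnLine c₂ t →
      (∀ w → (dot c₂ w ≈ 0# → dot (d b) w ≈ 0#) × (dot (d b) w ≈ 0# → dot c₂ w ≈ 0#)) → Type2With M T P c₂ S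
    type2With {a} {b} {S} δ≈0 rep c₂ c₂-line c₂⊥t c₂≃d =
      c₂-line , (t , t-real , t≉0 , c₂⊥t , T∼Mt)
      , c₁ , (c₁-real , c₁≉0) , (p , p≉0 , c₁⊥p , ∼-reflexive P≈Mp)
      , λ v v≉0 → (λ (Sv , w , w-real , w≉0 , v∼) →
            on-line v w w-real w≉0 v∼ (dot c₁ w ≟ 0#) (Cond⇒form a b w w-real (proj₁ (rep v w v∼ w≉0) Sv)))
        , λ { (inj₁ (w , w-real , w≉0 , c₁w , v∼)) → in-pencil v w w-real w≉0 v∼ (trans (*-congʳ c₁w) (zeroˡ _))
            ; (inj₂ (w , w-real , w≉0 , c₂w , v∼)) → in-pencil v w w-real w≉0 v∼
                (trans (*-congˡ (proj₁ (c₂≃d w) c₂w)) (zeroʳ _)) }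
      where
      split : ∀ w → form a b w ≈ dot c₁ w * dot (d b) w
      split w = combine (scal ∷ scal ∷ scal ∷ scal ∷ [])
        (λ x Δ δ y → (x :- Δ :* δ :* y := x) , (:- (Δ :* y) , δ := :0) ∷ []) ≡.refl
        (dot c₁ w * dot (d b) w) Δ (δ a b) (dot B w * dot B̄ w) δ≈0
      on-line : ∀ v w → InK³ w → NonZero w → v ∼ apply M w → Dec (dot c₁ w ≈ 0#) → form a b w ≈ 0# →
        (BLine M c₁ ∪ BLine M c₂) v
      on-line v w w-real w≉0 v∼ (yes c₁w) _ = inj₁ (w , w-real , w≉0 , c₁w , v∼)
      on-line v w w-real w≉0 v∼ (no c₁w≉0) h = inj₂ (w , w-real , w≉0
        , proj₂ (c₂≃d w) (*-cancelˡ-0# c₁w≉0 (trans (sym (split w)) h)) , v∼)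
      in-pencil : ∀ v w → InK³ w → NonZero w → v ∼ apply M w → dot c₁ w * dot (d b) w ≈ 0# → (S ∩ Baer M) v
      in-pencil v w w-real w≉0 v∼ h =
        proj₂ (rep v w v∼ w≉0) (form⇒Cond a b w w-real (trans (split w) h)) , w , w-real , w≉0 , v∼

    type2 : ∀ {a b S} → ¬ (b ≈ 0#) → δ a b ≈ 0# → Represents a b S → Type2 M T P S
    type2 {a} {b} b≉0 δ≈0 rep =
      d b , type2With δ≈0 rep (d b) (d-real b , d≉0 b b≉0) (d⊥t b) (λ w → (λ h → h) , λ h → h)

    evalQ-∼ : ∀ Q {u w} → u ∼ w → evalQ Q w ≈ 0# → evalQ Q u ≈ 0#
    evalQ-∼ (qform a b c f g h) {u} {w} (k , _ , e) Qw = combine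
      (scal ∷ scal ∷ scal ∷ scal ∷ scal ∷ scal ∷ vec ∷ vec ∷ scal ∷ [])
      (λ a b c f g h u w k → let
          x = u 0F ; y = u 1F ; z = u 2F ; x′ = k :* w 0F ; y′ = k :* w 1F ; z′ = k :* w 2F
        in (:evalQ a b c f g h x y z := :0)
          , (a :* (x :+ x′) :+ g :* z :+ h :* y , x := x′)
          ∷ (b :* (y :+ y′) :+ f :* z :+ h :* x′ , y := y′)
          ∷ (c :* (z :+ z′) :+ f :* y′ :+ g :* x′ , z := z′)
          ∷ (k :* k , :evalQ a b c f g h (w 0F) (w 1F) (w 2F) := :0) ∷ []) ≡.refl
      a b c f g h u w k (e 0F) (e 1F) (e 2F) Qw

    -- Three points of the line suffice, and for `q = 2` it has no more. Permuting the coordinates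
    -- reduces each case to `conic⊇line⇒degenerate`, where the last coordinate of the line is
    -- nonzero.
    conic-contains-no-line : ∀ Q → ¬ (discriminant Q ≈ 0#) → (c₂ : V) → KLine c₂ →
      ¬ (∀ w → InK³ w → NonZero w → OnLine c₂ w → evalQ Q w ≈ 0#)
    conic-contains-no-line (qform a b c f g h) disc≉0 c₂ (c₂-real , c₂≉0) onQ =
      by-coordinate (nonzero-coordinate c₂≉0)
      where
      l′ m′ n′ : Carrier
      l′ = c₂ 0F
      m′ = c₂ 1F
      n′ = c₂ 2F
      l-real : InK l′
      l-real = c₂-real 0F
      m-real : InK m′
      m-real = c₂-real 1F
      n-real : InK n′
      n-real = c₂-real 2F
      Q₀ : Carrier → Carrier → Carrier → Carrier
      Q₀ x y z = evalQ (qform a b c f g h) (forall₃ x y z)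
      point : ∀ x y z → InK x → InK y → InK z → (∃ λ i → ¬ (forall₃ x y z i ≈ 0#)) →
        c₂ 0F * x + c₂ 1F * y + c₂ 2F * z ≈ 0# → Q₀ x y z ≈ 0#
      point x y z hx hy hz (i , nz) on = onQ (forall₃ x y z) (forall₃ hx hy hz) (λ e → nz (e i)) on
      swap-yz : ∀ x y z → Q₀ x y z ≈ 0# → evalQ (qform a c b f h g) (forall₃ x z y) ≈ 0#
      swap-yz x y z = trans (solve (scal ∷ scal ∷ scal ∷ scal ∷ scal ∷ scal ∷ scal ∷ scal ∷ scal ∷ [])
        (λ a b c f g h x y z → :evalQ a c b f h g x z y := :evalQ a b c f g h x y z) ≡.refl a b c f g h x y z)
      swap-xz : ∀ x y z → Q₀ x y z ≈ 0# → evalQ (qform c b a h g f) (forall₃ z y x) ≈ 0#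
      swap-xz x y z = trans (solve (scal ∷ scal ∷ scal ∷ scal ∷ scal ∷ scal ∷ scal ∷ scal ∷ scal ∷ [])
        (λ a b c f g h x y z → :evalQ c b a h g f z y x := :evalQ a b c f g h x y z) ≡.refl a b c f g h x y z)
      by-coordinate : ¬ (∃ λ i → ¬ (c₂ i ≈ 0#))
      by-coordinate (2F , n≉0) = disc≉0 (conic⊇line⇒degenerate a b c f g h l′ m′ n′ n≉0
        (point n′ 0# (- l′) n-real bar-0# (InK-neg l-real) (0F , n≉0)
          (solve (scal ∷ scal ∷ scal ∷ []) (λ l m n → l :* n :+ m :* :0 :+ n :* :- l := :0) ≡.refl l′ m′ n′))
        (point 0# n′ (- m′) bar-0# n-real (InK-neg m-real) (1F , n≉0)
          (solve (scal ∷ scal ∷ scal ∷ []) (λ l m n → l :* :0 :+ m :* n :+ n :* :- m := :0) ≡.refl l′ m′ n′))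
        (point n′ n′ (- l′ - m′) n-real n-real (InK-sub (InK-neg l-real) m-real) (0F , n≉0)
          (solve (scal ∷ scal ∷ scal ∷ []) (λ l m n → l :* n :+ m :* n :+ n :* (:- l :- m) := :0) ≡.refl l′ m′ n′)))
      by-coordinate (1F , m≉0) = disc≉0 (trans (solve (scal ∷ scal ∷ scal ∷ scal ∷ scal ∷ scal ∷ [])
          (λ a b c f g h → :discriminant a b c f g h := :discriminant a c b f h g) ≡.refl a b c f g h)
        (conic⊇line⇒degenerate a c b f h g l′ n′ m′ m≉0
        (swap-yz _ _ _ (point m′ (- l′) 0# m-real (InK-neg l-real) bar-0# (0F , m≉0)
          (solve (scal ∷ scal ∷ scal ∷ []) (λ l m n → l :* m :+ m :* :- l :+ n :* :0 := :0) ≡.refl l′ m′ n′)))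
        (swap-yz _ _ _ (point 0# (- n′) m′ bar-0# (InK-neg n-real) m-real (2F , m≉0)
          (solve (scal ∷ scal ∷ scal ∷ []) (λ l m n → l :* :0 :+ m :* :- n :+ n :* m := :0) ≡.refl l′ m′ n′)))
        (swap-yz _ _ _ (point m′ (- l′ - n′) m′ m-real (InK-sub (InK-neg l-real) n-real) m-real (0F , m≉0)
          (solve (scal ∷ scal ∷ scal ∷ []) (λ l m n → l :* m :+ m :* (:- l :- n) :+ n :* m := :0) ≡.refl l′ m′ n′)))))
      by-coordinate (0F , l≉0) = disc≉0 (trans (solve (scal ∷ scal ∷ scal ∷ scal ∷ scal ∷ scal ∷ [])
          (λ a b c f g h → :discriminant a b c f g h := :discriminant c b a h g f) ≡.refl a b c f g h)
        (conic⊇line⇒degenerate c b a h g f n′ m′ l′ l≉0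
        (swap-xz _ _ _ (point (- n′) 0# l′ (InK-neg n-real) bar-0# l-real (2F , l≉0)
          (solve (scal ∷ scal ∷ scal ∷ []) (λ l m n → l :* :- n :+ m :* :0 :+ n :* l := :0) ≡.refl l′ m′ n′)))
        (swap-xz _ _ _ (point (- m′) l′ 0# (InK-neg m-real) l-real bar-0# (1F , l≉0)
          (solve (scal ∷ scal ∷ scal ∷ []) (λ l m n → l :* :- m :+ m :* l :+ n :* :0 := :0) ≡.refl l′ m′ n′)))
        (swap-xz _ _ _ (point (- n′ - m′) l′ l′ (InK-sub (InK-neg n-real) m-real) l-real l-real (1F , l≉0)
          (solve (scal ∷ scal ∷ scal ∷ []) (λ l m n → l :* (:- n :- m) :+ m :* l :+ n :* l := :0) ≡.refl l′ m′ n′)))))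

    -- Otherwise the conic would contain the line `c₂`. Through this lemma the type of a pencil
    -- decides whether `δ` vanishes, which makes both enumerations complete.
    types-exclusive : ∀ {S} → Type1 M T S → ¬ Type2 M T P S
    types-exclusive {S} (Q , (_ , disc≉0) , _ , S-conic) (c₂ , c₂-line , _ , c₁′ , _ , _ , S-lines) =
      conic-contains-no-line Q disc≉0 c₂ c₂-line onQ
      where
      on-conic : ∀ w → BConic M Q (apply M w) → evalQ Q w ≈ 0#
      on-conic w (w′ , _ , _ , Qw′ , Mw∼) = evalQ-∼ Q {w} {w′} (apply-∼⁻¹ Mw∼) Qw′
      onQ : ∀ w → InK³ w → NonZero w → OnLine c₂ w → evalQ Q w ≈ 0#
      onQ w w-real w≉0 on = on-conic w (proj₁ (S-conic (apply M w) Mw≉0)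
        (proj₂ (S-lines (apply M w) Mw≉0) (inj₂ (w , w-real , w≉0 , on , ∼-refl))))
        where
        Mw≉0 : NonZero (apply M w)
        Mw≉0 = apply-NonZero w≉0

    dot-proportional : ∀ k a b w → (∀ i → a i ≈ k * b i) → dot a w ≈ k * dot b w
    dot-proportional k a b w h = trans (dot-cong {a} {λ i → k * b i} {w} h (λ _ → refl))
      (solve (scal ∷ vec ∷ vec ∷ []) (λ k b w → :dot (λ i → k :* b i) w := k :* :dot b w) ≡.refl k b w)

    dot-p̄ : ∀ c → InK³ c → bar (dot c p̄) ≈ dot c p
    dot-p̄ c c-real = trans (bar-dot c p̄) (dot-cong {conjᵥ c} {c} c-real (λ i → bar-involutive (p i)))

    dot-p : ∀ c → InK³ c → bar (dot c p) ≈ dot c p̄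
    dot-p c c-real = trans (bar-dot c p) (dot-cong {conjᵥ c} {c} {p̄} c-real (λ _ → refl))

    -- A real line through `p` also passes through `p̄`, so it is the line joining the two.
    kline-through-P : ∀ c → KLine c → BLineExt M c P → BLine M c ≐ BLine M c₁
    kline-through-P c (c-real , c≉0) (w′ , w′≉0 , c⊥w′ , P∼Mw′) v v≉0 =
        (λ (w , w-real , w≉0 , on , v∼) → w , w-real , w≉0 , *-cancelˡ-0# ct≉0
          (trans (sym (proportional w)) (trans (*-congˡ on) (zeroʳ _))) , v∼)
      , λ (w , w-real , w≉0 , on , v∼) → w , w-real , w≉0 , *-cancelˡ-0# ΔΔ≉0
          (trans (proportional w) (trans (*-congˡ on) (zeroʳ _))) , v∼
      where
      c⊥p : OnLine c p
      c⊥p = OnLine-∼ c {w′} {p} (apply-∼⁻¹ (∼-trans (∼-sym P∼Mw′) (∼-reflexive P≈Mp))) c⊥w′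
      c⊥p̄ : OnLine c p̄
      c⊥p̄ = trans (sym (dot-p c c-real)) (trans (bar-cong c⊥p) bar-0#)
      coefficients : ∀ i → ΔΔ * c i ≈ dot c t * c₁ i
      coefficients i = combine (scal ∷ scal ∷ scal ∷ scal ∷ scal ∷ scal ∷ scal ∷ scal ∷ [])
        (λ Δ ci x y z x′ y′ z′ → (Δ :* Δ :* ci := z :* (Δ :* z′))
          , (Δ , Δ :* ci := x :* x′ :+ y :* y′ :+ z :* z′) ∷ (Δ :* x′ , x := :0) ∷ (Δ :* y′ , y := :0) ∷ []) ≡.refl
        Δ (c i) (dot c p) (dot c p̄) (dot c t) ((p̄ ⨯ t) i) ((t ⨯ p) i) ((p ⨯ p̄) i)
        (dual-expansion c p p̄ t i) c⊥p c⊥p̄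
      ct≉0 : ¬ (dot c t ≈ 0#)
      ct≉0 e = c≉0 λ i → *-cancelˡ-0# ΔΔ≉0 (trans (coefficients i) (trans (*-congʳ e) (zeroˡ _)))
      proportional : ∀ w → ΔΔ * dot c w ≈ dot c t * dot c₁ w
      proportional w = trans (sym (dot-proportional ΔΔ (λ i → ΔΔ * c i) c w (λ _ → refl)))
        (dot-proportional (dot c t) (λ i → ΔΔ * c i) c₁ w coefficients)

    -- A real line through `t` is determined by its value `b` at `p̄`, its value at `p` being
    -- `bar b`. The dual expansion then gives `d b = - ΔΔ c`, so each of these lines arises from a
    -- K-line through 0.
    kline-through-T : ∀ c → KLine c → OnLine c t → ∃ λ b → ¬ (b ≈ 0#) ×
      (∀ {S} → Represents 0# b S → Type2With M T P c S)
    kline-through-T c (c-real , c≉0) c⊥t = b , b≉0 , λ rep → type2With δ≈0 rep c (c-real , c≉0) c⊥t λ w →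
        (λ h → trans (proportional w) (trans (*-congˡ h) (zeroʳ _)))
      , λ h → *-cancelˡ-0# (neg-nonzero ΔΔ≉0) (trans (sym (proportional w)) h)
      where
      b : Carrier
      b = dot c p̄
      δ≈0 : δ 0# b ≈ 0#
      δ≈0 = solve (scal ∷ []) (λ b → :0 :* conj b :- conj :0 :* b := :0) ≡.refl b
      expansion : ∀ i → Δ * c i ≈ bar b * - B̄ i + b * B i
      expansion i = trans (dual-expansion c p p̄ t i) (trans
        (+-cong (+-congʳ (*-cong (sym (dot-p̄ c c-real)) (⨯-anticomm p̄ t i))) (trans (*-congʳ c⊥t) (zeroˡ _)))
        (+-identityʳ _))
      b≉0 : ¬ (b ≈ 0#)
      b≉0 e = c≉0 λ i → *-cancelˡ-0# Δ≉0 (trans (expansion i) (combine (scal ∷ scal ∷ scal ∷ [])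
        (λ b x y → (conj b :* x :+ b :* y := :0) , (x , conj b := conj :0) ∷ (y , b := :0) ∷ []) ≡.refl
        b (- B̄ i) (B i) (bar-cong e) e))
      coefficients : ∀ i → d b i ≈ - ΔΔ * c i
      coefficients i = combine (scal ∷ scal ∷ scal ∷ scal ∷ scal ∷ scal ∷ [])
        (λ Δ ci b b̄ x y → (Δ :* (b̄ :* y :- b :* x) := :- (Δ :* Δ) :* ci)
          , (Δ , Δ :* ci := b̄ :* :- y :+ b :* x) ∷ []) ≡.refl Δ (c i) b (bar b) (B i) (B̄ i) (expansion i)
      proportional : ∀ w → dot (d b) w ≈ - ΔΔ * dot c w
      proportional w = dot-proportional (- ΔΔ) (d b) c w coefficients

    -- Enumeration of the pencils of each type

    module Counting (xs : List Carrier) (|xs|≡q² : length xs ≡ q ℕ.* q)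
      (xs! : AllPairs (λ a b → ¬ (a ≈ b)) xs) (complete : ∀ x → x ∈ xs) where

      open Skew ω ω∉K using (ωK∩K; Ks; ∈-Ks; Ks-real; Ks!; length-Ks)

      F* K-list : List Carrier
      F* = nonzeros xs xs! complete
      K-list = Ks xs xs! complete

      -- The affine K-lines a + Kb off 0, that is with δ a b ≉ 0, are up to
      -- equivalence determined by b / δ a b, which is arbitrary in F*. The
      -- representative with δ a b = ε is a = ω / bar b.
      shift : Carrier → Carrier
      shift c = ω * inverse-or-0# (bar c) (bar c ≟ 0#)

      shift-spec : ∀ {c} → ¬ (c ≈ 0#) → shift c * bar c ≈ ω
      shift-spec {c} c≉0 = trans (*-assoc _ _ _) (trans (*-congˡ (trans (*-comm _ _)
        (*-inverse-or-0# (bar-nonzero c≉0) (bar c ≟ 0#)))) (*-identityʳ ω))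

      δ-shift : ∀ {c} → ¬ (c ≈ 0#) → δ (shift c) c ≈ ε
      δ-shift {c} c≉0 = combine (scal ∷ scal ∷ scal ∷ [])
        (λ ω a c → (a :* conj c :- conj a :* c := ω :- conj ω)
          , (:1 , a :* conj c := ω) ∷ (:- :1 , conj (a :* conj c) := conj ω) ∷ []) ≡.refl
        ω (shift c) c (shift-spec c≉0) (bar-cong (shift-spec c≉0))

      pencil₁ pencil₂ : Carrier → V × V
      pencil₁ c = X[ c ] , Y[ shift c ]
      pencil₂ b = X[ b ] , Y[ 0# ]

      δ-zero : ∀ b → δ 0# b ≈ 0#
      δ-zero = solve (scal ∷ []) (λ b → :0 :* conj b :- conj :0 :* b := :0) ≡.refl

      type1⇒δ≉0 : ∀ {a b S} → ¬ (b ≈ 0#) → Represents a b S → Type1 M T S → ¬ (δ a b ≈ 0#)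
      type1⇒δ≉0 b≉0 rep t₁ δ≈0 = types-exclusive t₁ (type2 b≉0 δ≈0 rep)

      type2⇒δ≈0 : ∀ {a b S} → ¬ (b ≈ 0#) → Represents a b S → Type2 M T P S → Dec (δ a b ≈ 0#) → δ a b ≈ 0#
      type2⇒δ≈0 b≉0 rep t₂ (yes e) = e
      type2⇒δ≈0 b≉0 rep t₂ (no h) = ⊥-elim (types-exclusive (type1 b≉0 h rep) t₂)

      -- Equal pencils make `c * bar c'` real, and multiplying the second condition by the norm of
      -- `c` makes `ω (c c̄' - c c̄)` real too. By `ωK∩K` the real factor `c c̄' - c c̄` vanishes,
      -- whence `c = c'`.
      distinct₁ : ∀ {c c'} → ¬ (c ≈ 0#) → ¬ (c' ≈ 0#) → ¬ (c ≈ c') →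
        ¬ (Pencil P X[ c ] Y[ shift c ] ≐ Pencil P X[ c' ] Y[ shift c' ])
      distinct₁ {c} {c'} c≉0 c'≉0 c≉c' same = c≉c' (equal (≐⇒equivalent
          (canonical-Represents (shift c) c≉0) (canonical-Represents (shift c') c'≉0) same))
        where
        equal : InK (c * bar c') × InK ((shift c - shift c') * bar c') → c ≈ c'
        equal (hc , ha) = trans (sym (bar-involutive c)) (trans (bar-cong (sym (*-cancelˡ-≉ c≉0
            (x-y≈0⇒x≈y (ωK∩K (InK-sub hc (InK-norm c)) (InK-cong (combine (scal ∷ scal ∷ scal ∷ scal ∷ scal ∷ [])
              (λ ω a a' c c' → (c :* conj c :* ((a :- a') :* conj c') := ω :* (c :* conj c' :- c :* conj c))
                , (c :* conj c' , a :* conj c := ω) ∷ (:- (c :* conj c) , a' :* conj c' := ω) ∷ []) ≡.refl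
              ω (shift c) (shift c') c c' (shift-spec c≉0) (shift-spec c'≉0)) (InK-* (InK-norm c) ha)))))))
          (bar-involutive c'))

      -- The factor `κ = ε / δ a b` is a quotient of skew elements, hence in K. Replacing `b` by
      -- `c = κ b` keeps the direction and gives `δ a c = ε`; then `a` and `shift c` differ by a
      -- K-multiple of `b`.
      listed₁ : ∀ {S a b} → ¬ (b ≈ 0#) → Represents a b S → ¬ (δ a b ≈ 0#) →
        Any (λ c → S ≐ Pencil P X[ c ] Y[ shift c ]) F*
      listed₁ {S} {a} {b} b≉0 rep δ≉0 = scaled (inverse (δ a b) δ≉0)
        where
        scaled : (∃ λ i → δ a b * i ≈ 1#) → Any (λ c → S ≐ Pencil P X[ c ] Y[ shift c ]) F*
        scaled (i , δi≈1) = Any.map same (∈-nonzeros xs xs! complete (*-nonzero κ≉0 b≉0))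
          where
          κ : Carrier
          κ = ε * i
          κδ : κ * δ a b ≈ ε
          κδ = combine (scal ∷ scal ∷ scal ∷ [])
            (λ e d i → (e :* i :* d := e) , (e , d :* i := :1) ∷ []) ≡.refl ε (δ a b) i δi≈1
          κ≉0 : ¬ (κ ≈ 0#)
          κ≉0 e = ε≉0 (trans (sym κδ) (trans (*-congʳ e) (zeroˡ _)))
          κ-real : InK κ
          κ-real = *-cancelˡ-≉ δ≉0 (combine (scal ∷ scal ∷ scal ∷ [])
            (λ ω κ d → (d :* conj κ := d :* κ)
              , (conj κ , conj d := :- d) ∷ (:- :1 , conj (κ :* d) := conj (ω :- conj ω))
              ∷ (:- :1 , κ :* d := ω :- conj ω) ∷ []) ≡.refl ω κ (δ a b) (bar-δ a b) (bar-cong κδ) κδ)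
          same : ∀ {c} → κ * b ≈ c → S ≐ Pencil P X[ c ] Y[ shift c ]
          same {c} e = equivalent⇒≐ rep (canonical-Represents (shift c) c≉0) b≉0 c≉0
            (InK-cong (combine (scal ∷ scal ∷ scal ∷ [])
              (λ κ b c → (κ :* (b :* conj b) := b :* conj c)
                , (:- b :* conj b , conj κ := κ) ∷ (b , conj (κ :* b) := conj c) ∷ []) ≡.refl
              κ b c κ-real (bar-cong e)) (InK-* κ-real (InK-norm b)))
            (InK-cancel κ≉0 κ-real (combine (scal ∷ scal ∷ scal ∷ scal ∷ scal ∷ [])
              (λ ω κ a a' b → (conj (κ :* ((a :- a') :* conj b)) := κ :* ((a :- a') :* conj b))
                , (conj a :* b , conj κ := κ) ∷ (:- :1 , conj (κ :* a' :* conj b) := conj ω)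
                ∷ (:1 , κ :* a' :* conj b := ω) ∷ (:- :1 , κ :* (a :* conj b :- conj a :* b) := ω :- conj ω) ∷ [])
              ≡.refl ω κ a (shift c) b κ-real (bar-cong κa'b) κa'b κδ))
            where
            c≉0 : ¬ (c ≈ 0#)
            c≉0 h = *-nonzero κ≉0 b≉0 (trans e h)
            κa'b : κ * shift c * bar b ≈ ω
            κa'b = combine (scal ∷ scal ∷ scal ∷ scal ∷ scal ∷ [])
              (λ ω κ a' b c → (κ :* a' :* conj b := ω)
                , (a' , conj (κ :* b) := conj c) ∷ (:1 , a' :* conj c := ω) ∷ (:- (a' :* conj b) , conj κ := κ) ∷ [])
              ≡.refl ω κ (shift c) b c (bar-cong e) (shift-spec c≉0) κ-real

      F*-nonzero : All (λ c → ¬ (c ≈ 0#)) F*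
      F*-nonzero = All.tabulateₛ setoid (nonzeros-≉0 xs xs! complete)

      exactly₁ : ExactlyPencils (q ℕ.* q ∸ 1) l P (Type1 M T)
      exactly₁ = map pencil₁ F*
        , ≡.trans (length-map pencil₁ F*) (≡.cong (_∸ 1) (≡.trans (length-nonzeros xs xs! complete) |xs|≡q²))
        , All.map⁺ (All.map (λ {c} c≉0 → canonical-LinfPencil (shift c) c≉0
            , type1 c≉0 (λ e → ε≉0 (trans (sym (δ-shift c≉0)) e)) (canonical-Represents (shift c) c≉0)) F*-nonzero)
        , AllPairs.map⁺ (AllPairs-refine distinct₁ F*-nonzero (nonzeros! xs xs! complete))
        , λ X Y linf t₁ → Any.map⁺ (listed X Y t₁ (represent X Y linf))
        where
        listed : ∀ X Y → Type1 M T (Pencil P X Y) → (∃₂ λ a b → ¬ (b ≈ 0#) × Represents a b (Pencil P X Y)) →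
          Any (λ c → Pencil P X Y ≐ Pencil P X[ c ] Y[ shift c ]) F*
        listed X Y t₁ (a , b , b≉0 , rep) = listed₁ b≉0 rep (type1⇒δ≉0 b≉0 rep t₁)

      -- Representatives of the `q + 1` one-dimensional K-subspaces of F: K itself, and the spans of
      -- `ω + k` for `k` in K.
      directions : List Carrier
      directions = 1# ∷ map (ω +_) K-list

      ω+k∉K : ∀ {k} → InK k → ¬ InK (ω + k)
      ω+k∉K {k} hk h = ω∉K (InK-cong (solve (scal ∷ scal ∷ []) (λ x k → x :+ k :- k := x) ≡.refl ω k) (InK-sub h hk))

      directions-nonzero : All (λ b → ¬ (b ≈ 0#)) directions
      directions-nonzero = (λ e → 0≉1 (sym e))
        ∷ All.map⁺ (All.map (λ hk e → ω+k∉K hk (InK-cong (sym e) bar-0#)) (Ks-real xs xs! complete))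

      -- If `bar (ω + k)` were real, so would be `ω`. For two directions of the second kind,
      -- subtracting from `(ω + k) * bar (ω + k')` its conjugate leaves `(ω - bar ω) * (k' - k)`.
      directions-distinct : AllPairs (λ b b' → ¬ InK (b * bar b')) directions
      directions-distinct = All.map⁺ (All.map (λ {k} hk h → ω+k∉K hk 
            (trans (sym (InK-cong (*-identityˡ (bar (ω + k))) h)) (bar-involutive (ω + k))))
            (Ks-real xs xs! complete))
        ∷ AllPairs.map⁺ (AllPairs-refine (λ {k} {k'} hk hk' k≉k' h → k≉k' (x-y≈0⇒x≈y (*-cancelˡ-0# ε≉0
            (combine (scal ∷ scal ∷ scal ∷ [])
              (λ ω k k' → ((ω :- conj ω) :* (k :- k') := :0)
                , (:1 , conj ((ω :+ k) :* conj (ω :+ k')) := (ω :+ k) :* conj (ω :+ k'))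
                ∷ (:- (ω :+ k') , conj k := k)
                ∷ (ω :+ k , conj k' := k') ∷ []) ≡.refl ω k k' h hk hk'))))
            (Ks-real xs xs! complete) (Ks! xs xs! complete))

      listed₂ : ∀ {S a b} → ¬ (b ≈ 0#) → Represents a b S → δ a b ≈ 0# → Dec (InK b) →
        Any (λ c → S ≐ Pencil P X[ c ] Y[ 0# ]) directions
      listed₂ {S} {a} {b} b≉0 rep δ≈0 = by-cases
        where
        equal : ∀ {c} → ¬ (c ≈ 0#) → InK (b * bar c) → S ≐ Pencil P X[ c ] Y[ 0# ]
        equal {c} c≉0 h = equivalent⇒≐ rep (canonical-Represents 0# c≉0) b≉0 c≉0 h
          (combine (scal ∷ scal ∷ []) (λ a b → (conj ((a :- :0) :* conj b) := (a :- :0) :* conj b)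
            , (:- :1 , a :* conj b :- conj a :* b := :0) ∷ []) ≡.refl a b δ≈0)
        by-cases : Dec (InK b) → Any (λ c → S ≐ Pencil P X[ c ] Y[ 0# ]) directions
        by-cases (yes hb) = here (equal (λ e → 0≉1 (sym e)) (InK-* hb (InK-cong (sym bar-1#) bar-1#)))
        by-cases (no b∉K) = there (Any.map⁺ (slope (inverse (b - bar b) (λ e → b∉K (sym (x-y≈0⇒x≈y e))))))
          where
          slope : (∃ λ i → (b - bar b) * i ≈ 1#) → Any (λ k → S ≐ Pencil P X[ ω + k ] Y[ 0# ]) K-list
          slope (i , bi≈1) = Any.map
              (λ {k} e → let hk = InK-cong e κ-real in
                equal (λ z → ω+k∉K hk (InK-cong (sym z) bar-0#)) (InK-cong (*-congˡ (bar-cong (+-congˡ e))) real))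
              (∈-Ks xs xs! complete κ-real)
            where
            -- The solution of `b * bar (ω + κ) = bar b * (ω + κ)` for real `κ`, which expresses
            -- that `ω + κ` has the direction of `b`.
            κ : Carrier
            κ = (bar b * ω - b * bar ω) * i
            κ-spec : (b - bar b) * κ ≈ bar b * ω - b * bar ω
            κ-spec = combine (scal ∷ scal ∷ scal ∷ [])
              (λ d e i → (d :* (e :* i) := e) , (e , d :* i := :1) ∷ []) ≡.refl (b - bar b) (bar b * ω - b * bar ω) i bi≈1
            κ-real : InK κ
            κ-real = *-cancelˡ-≉ (λ e → b∉K (sym (x-y≈0⇒x≈y e))) (combine (scal ∷ scal ∷ scal ∷ [])
              (λ ω b κ → ((b :- conj b) :* conj κ := (b :- conj b) :* κ)
                , (:- :1 , conj ((b :- conj b) :* κ) := conj (conj b :* ω :- b :* conj ω))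
                ∷ (:- :1 , (b :- conj b) :* κ := conj b :* ω :- b :* conj ω) ∷ []) ≡.refl
              ω b κ (bar-cong κ-spec) κ-spec)
            real : InK (b * bar (ω + κ))
            real = combine (scal ∷ scal ∷ scal ∷ [])
              (λ ω b κ → (conj (b :* conj (ω :+ κ)) := b :* conj (ω :+ κ))
                , (:- :1 , (b :- conj b) :* κ := conj b :* ω :- b :* conj ω) ∷ (:- b , conj κ := κ) ∷ []) ≡.refl
              ω b κ κ-spec κ-real

      exactly₂ : ExactlyPencils (q ℕ.+ 1) l P (Type2 M T P)
      exactly₂ = map pencil₂ directions
        , ≡.trans (length-map pencil₂ directions) (≡.trans (≡.cong suc (≡.trans (length-map (ω +_) K-list)
            (length-Ks xs xs! complete |xs|≡q²))) (ℕₚ.+-comm 1 q))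
        , All.map⁺ (All.map (λ {b} b≉0 → canonical-LinfPencil 0# b≉0
            , type2 b≉0 (δ-zero b) (canonical-Represents 0# b≉0)) directions-nonzero)
        , AllPairs.map⁺ (AllPairs-refine (λ b≉0 b'≉0 h same → h (proj₁ (≐⇒equivalent
            (canonical-Represents 0# b≉0) (canonical-Represents 0# b'≉0) same)))
            directions-nonzero directions-distinct)
        , λ X Y linf t₂ → Any.map⁺ (listed X Y t₂ (represent X Y linf))
        where
        listed : ∀ X Y → Type2 M T P (Pencil P X Y) → (∃₂ λ a b → ¬ (b ≈ 0#) × Represents a b (Pencil P X Y)) →
          Any (λ c → Pencil P X Y ≐ Pencil P X[ c ] Y[ 0# ]) directions
        listed X Y t₂ (a , b , b≉0 , rep) = listed₂ b≉0 rep (type2⇒δ≈0 b≉0 rep t₂ (δ a b ≟ 0#)) (InK? b)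

    type1⊎type2 : ∀ X Y → LinfPencil l P X Y → Type1 M T (Pencil P X Y) ⊎ Type2 M T P (Pencil P X Y)
    type1⊎type2 X Y linf = classify (represent X Y linf)
      where
      by-δ : ∀ {a b} → ¬ (b ≈ 0#) → Represents a b (Pencil P X Y) → Dec (δ a b ≈ 0#) →
        Type1 M T (Pencil P X Y) ⊎ Type2 M T P (Pencil P X Y)
      by-δ b≉0 rep (yes δ≈0) = inj₂ (type2 b≉0 δ≈0 rep)
      by-δ b≉0 rep (no δ≉0) = inj₁ (type1 b≉0 δ≉0 rep)
      classify : (∃₂ λ a b → ¬ (b ≈ 0#) × Represents a b (Pencil P X Y)) →
        Type1 M T (Pencil P X Y) ⊎ Type2 M T P (Pencil P X Y)
      classify (a , b , b≉0 , rep) = by-δ b≉0 rep (δ a b ≟ 0#)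

    unique-kline-through-P : ∃ λ c → KLine c × BLineExt M c P
      × (∀ c' → KLine c' → BLineExt M c' P → BLine M c' ≐ BLine M c)
    unique-kline-through-P =
      c₁ , (c₁-real , c₁≉0) , (p , p≉0 , c₁⊥p , ∼-reflexive P≈Mp) , kline-through-P

    pencil-with-line-through-T : ∀ c → KLine c → BLine M c T →
      ∃ λ X → ∃ λ Y → LinfPencil l P X Y × Type2With M T P c (Pencil P X Y)
    pencil-with-line-through-T c c-line (w , _ , _ , c⊥w , T∼Mw) =
      pencil (kline-through-T c c-line (OnLine-∼ c {w} {t} (apply-∼⁻¹ (∼-trans (∼-sym T∼Mw) T∼Mt)) c⊥w))
      where
      pencil : (∃ λ b → ¬ (b ≈ 0#) × (∀ {S} → Represents 0# b S → Type2With M T P c S)) →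
        ∃ λ X → ∃ λ Y → LinfPencil l P X Y × Type2With M T P c (Pencil P X Y)
      pencil (b , b≉0 , h) = X[ b ] , Y[ 0# ] , canonical-LinfPencil 0# b≉0 , h (canonical-Represents 0# b≉0)

open import Data.Nat using (_*_; _+_)

theorem2p12 : ∀ {c ℓ : Level} (q : ℕ) (F : Field c ℓ) → PrimePower q → HasSize F (q * q)
    → Decidable (Field._≈_ F)
    → let open PG F q in
    (l : V) → NonZero l
    → (M : Matrix) → Nonsingular M
    → (T : V) → TangentAt l M T
    → (P : V) → NonZero P → OnLine l P → ¬ (P ∼ T)
    → (∀ x y → LinfPencil l P x y → Type1 M T (Pencil P x y) ⊎ Type2 M T P (Pencil P x y))
    × (∃ λ c₁ → KLine c₁ × BLineExt M c₁ P
    × (∀ c' → KLine c' → BLineExt M c' P → BLine M c' ≐ BLine M c₁))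
    × ExactlyPencils (q * q ∸ 1) l P (Type1 M T)
    × ExactlyPencils (q + 1) l P (Type2 M T P)
    × (∀ c₂ → KLine c₂ → BLine M c₂ T
    → ∃ λ x → ∃ λ y → LinfPencil l P x y × Type2With M T P c₂ (Pencil P x y))
theorem2p12 q F q-primePower (xs , |xs|≡q² , complete , xs!) _≟_ l l≉0 M detM≉0
    T (_ , (t , t-real , t≉0 , T∼Mt) , l⊥T , l-tangent) P P≉0 l⊥P P≁T =
  type1⊎type2 , unique-kline-through-P , exactly₁ , exactly₂ , pencil-with-line-through-T
  where
  open Field F using (trans; sym)
  open PG F q
  open FiniteField F _≟_ using (pow-q-+; pow-q-involutive)
  -- The list of all elements supplies the two Frobenius laws on which the geometry is parametrised.
  open Geometry F q _≟_ (pow-q-+ q xs |xs|≡q² xs! complete q-primePower) (pow-q-involutive q xs |xs|≡q² xs! complete)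
  open Coordinates M detM≉0

  n p : V
  n = pullback l
  p = N P

  tangent : ∀ w → InK³ w → NonZero w → OnLine n w → w ∼ t
  tangent w w-real w≉0 n⊥w = apply-∼⁻¹ (∼-trans (l-tangent (apply M w) (apply-NonZero w≉0)
    (w , w-real , w≉0 , ∼-refl) (trans (sym (dot-pullback l w)) n⊥w)) T∼Mt)

  open Configuration M detM≉0 l P T n p t (dot-pullback l) (pullback-NonZero l≉0)
    P≉0 l⊥P (apply-N P) t-real t≉0 T∼Mt
    (trans (dot-pullback l p) (OnLine-cong l (apply-N P) l⊥P))
    (trans (dot-pullback l t) (OnLine-∼ l T∼Mt l⊥T))
    (NonZero-apply (∼-reflexive (apply-N P)) P≉0)
    (λ p∼t → P≁T (∼-trans (∼-reflexive (apply-N P)) (∼-trans (apply-∼ p∼t) (∼-sym T∼Mt))))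
    tangent
    using (type1⊎type2; unique-kline-through-P; pencil-with-line-through-T; module Counting)
  open Counting xs |xs|≡q² xs! complete using (exactly₁; exactly₂)
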